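{- Fix $s,t\in\mathbb{N}$ and let $\mathcal{G}$ be a minor-closed class such that every graph with treewidth at most $s$ is in $\mathcal{G}$ and $K_{s+1,t}\notin\mathcal{G}$. Then for every fixed forest $T$, $$C(T,\mathcal{G},n)\in\Theta(n^{\alpha_s(T)})\quad (n\to\infty).$$
   Context: All graphs are finite, simple and undirected. A graph class $\mathcal{G}$ is minor-closed if some graph is not in $\mathcal{G}$ and every minor of every graph in $\mathcal{G}$ is in $\mathcal{G}$. For graphs $H,G$, $C(H,G)$ denotes the number of subgraphs of $G$ isomorphic to $H$. For a graph class $\mathcal{G}$, $C(H,\mathcal{G},n):=\max\{C(H,G): G\in\mathcal{G},\ |V(G)|=n\}$. For a graph $G$ and $s\in\mathbb{N}_0$, $\alpha_s(G)$ is the maximum size of a stable set in the subgraph of $G$ induced by the vertices of degree at most $s$ in $G$. $\Theta(n^a)$ means bounded above and below by positive constant multiples of $n^a$ for all sufficiently large $n$ (constants depending on $T$ and $\mathcal{G}$). -}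

module Defs where

open import Data.Nat using (ℕ; zero; suc; _+_; _*_; _^_; _≤_; _<ᵇ_; _⊔_)
open import Data.Bool using (Bool; true; false; not; _∧_; _∨_; _xor_; T)
open import Data.Bool.Properties using (xor-same)
open import Data.Fin using (Fin; zero; suc; toℕ; inject₁; fromℕ; _≟_)
open import Data.Fin.Subset using (Subset; _∈_; ∣_∣)
open import Data.Vec using (Vec; []; _∷_; lookup)
import Data.Vec.Functional as VF
open import Data.List using (List; []; _∷_; map; concatMap; length; filterᵇ; foldr; allFin)
open import Data.Bool.ListAction using (all; any)
open import Data.Product using (Σ; _×_; _,_)
open import Data.Unit using (⊤)
open import Relation.Binary.PropositionalEquality using (_≡_; refl)
open import Relation.Nullary using (¬_; does)
open import Function.Definitions using (Injective)

record Graph : Set where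
  field
    n       : ℕ
    adj     : Fin n → Fin n → Bool
    adj-sym : ∀ i j → adj i j ≡ adj j i
    adj-irr : ∀ i → adj i i ≡ false

open Graph public

V : Graph → Set
V G = Fin (n G)

data WalkIn (G : Graph) (P : V G → Set) : V G → V G → Set where
  here : ∀ {x} → P x → WalkIn G P x x
  step : ∀ {x y z} → P x → adj G x y ≡ true → WalkIn G P y z → WalkIn G P x z

Connected : Graph → Set
Connected G = ∀ x y → WalkIn G (λ _ → ⊤) x y

HasCycle : Graph → Set
HasCycle G =
  Σ ℕ λ k → Σ (Fin (3 + k) → V G) λ c →
    Injective _≡_ _≡_ c
    × (∀ (i : Fin (2 + k)) → adj G (c (inject₁ i)) (c (suc i)) ≡ true)
    × adj G (c (fromℕ (2 + k))) (c zero) ≡ true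

Forest : Graph → Set
Forest G = ¬ HasCycle G

Tree : Graph → Set
Tree G = Forest G × Connected G × 1 ≤ n G

-- Minors: H is a minor of G iff there are pairwise disjoint, nonempty,
-- connected branch sets B_v ⊆ V(G) (v ∈ V(H)) with an edge of G between
-- B_u and B_v whenever uv ∈ E(H).  Disjointness is built in by encoding
-- the branch sets as a partial map β : V(G) → V(H) (x ∈ B_v iff β x ≡ just v).

open import Data.Maybe using (Maybe; just; nothing)

record Minor (H G : Graph) : Set where
  field
    β         : V G → Maybe (V H)
    nonempty  : ∀ v → Σ (V G) λ x → β x ≡ just v
    connected : ∀ v x y → β x ≡ just v → β y ≡ just v →
                WalkIn G (λ z → β z ≡ just v) x y
    edges     : ∀ u v → adj H u v ≡ true →
                Σ (V G) λ x → Σ (V G) λ y →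
                  β x ≡ just u × β y ≡ just v × adj G x y ≡ true

MinorClosed : (Graph → Set) → Set
MinorClosed 𝒢 = (Σ Graph λ G → ¬ 𝒢 G) × (∀ G H → 𝒢 G → Minor H G → 𝒢 H)

record TreeDecomposition (s : ℕ) (G : Graph) : Set where
  field
    D        : Graph
    D-tree   : Tree D
    bag      : V D → Subset (n G)
    cover-v  : ∀ x → Σ (V D) λ t → x ∈ bag t
    cover-e  : ∀ x y → adj G x y ≡ true → Σ (V D) λ t → x ∈ bag t × y ∈ bag t
    subtree  : ∀ x t₁ t₂ → x ∈ bag t₁ → x ∈ bag t₂ →
               WalkIn D (λ t → x ∈ bag t) t₁ t₂
    width    : ∀ t → ∣ bag t ∣ ≤ suc s

TreewidthAtMost : ℕ → Graph → Set
TreewidthAtMost s G = TreeDecomposition s G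

private
  xor-comm : ∀ x y → x xor y ≡ y xor x
  xor-comm false false = refl
  xor-comm false true  = refl
  xor-comm true  false = refl
  xor-comm true  true  = refl

K : ℕ → ℕ → Graph
K a b = record
  { n       = a + b
  ; adj     = λ i j → side i xor side j
  ; adj-sym = λ i j → xor-comm (side i) (side j)
  ; adj-irr = λ i → xor-same (side i)
  }
  where
  side : Fin (a + b) → Bool
  side i = toℕ i <ᵇ a

allVecs : ∀ {A : Set} → List A → (m : ℕ) → List (Vec A m)
allVecs xs zero    = [] ∷ []
allVecs xs (suc m) = concatMap (λ v → map (λ x → x ∷ v) xs) (allVecs xs m)

allFuns : (m k : ℕ) → List (Fin m → Fin k)
allFuns zero    k = (λ ()) ∷ []
allFuns (suc m) k = concatMap (λ f → map (λ x → x VF.∷ f) (allFin k)) (allFuns m k)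

∀ᵇ : ∀ {m} → (Fin m → Bool) → Bool
∀ᵇ {m} p = all p (allFin m)

∃ᵇ : ∀ {m} → (Fin m → Bool) → Bool
∃ᵇ {m} p = any p (allFin m)

_==_ : ∀ {m} → Fin m → Fin m → Bool
i == j = does (i ≟ j)

_⇒ᵇ_ : Bool → Bool → Bool
a ⇒ᵇ b = not a ∨ b

_⇔ᵇ_ : Bool → Bool → Bool
a ⇔ᵇ b = not (a xor b)

-- Subgraphs of G: pairs (V', E') with V' ⊆ V(G) and E' ⊆ E(G) an edge set
-- on V' (E' stored as a symmetric, irreflexive 0/1 adjacency matrix, which
-- corresponds bijectively to a set of unordered pairs).

SubgraphData : ℕ → Set
SubgraphData k = Subset k × Vec (Vec Bool k) k

IsSubgraph : (G : Graph) → SubgraphData (n G) → Bool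
IsSubgraph G (S , E) =
  ∀ᵇ λ x → ∀ᵇ λ y →
    (e x y ⇔ᵇ e y x) ∧ not (e x x)
    ∧ (e x y ⇒ᵇ (adj G x y ∧ lookup S x ∧ lookup S y))
  where e = λ x y → lookup (lookup E x) y

IsoTo : (H : Graph) {k : ℕ} → SubgraphData k → Bool
IsoTo H {k} (S , E) = any ok (allFuns (n H) k)
  where
  ok : (Fin (n H) → Fin k) → Bool
  ok g = (∀ᵇ λ u → ∀ᵇ λ v → (g u == g v) ⇒ᵇ (u == v))
       ∧ (∀ᵇ λ x → lookup S x ⇔ᵇ (∃ᵇ λ u → g u == x))
       ∧ (∀ᵇ λ u → ∀ᵇ λ v → adj H u v ⇔ᵇ lookup (lookup E (g u)) (g v))

allBools : List Bool
allBools = true ∷ false ∷ []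

C : Graph → Graph → ℕ
C H G = length (filterᵇ (λ d → IsSubgraph G d ∧ IsoTo H d) candidates)
  where
  k = n G
  candidates : List (SubgraphData k)
  candidates = concatMap (λ S → map (λ E → S , E) (allVecs (allVecs allBools k) k))
                         (allVecs allBools k)

degree : (G : Graph) → V G → ℕ
degree G v = length (filterᵇ (adj G v) (allFin (n G)))

α : ℕ → Graph → ℕ
α s G = foldr _⊔_ 0 (map ∣_∣ (filterᵇ good (allVecs allBools (n G))))
  where
  good : Subset (n G) → Bool
  good S = ∀ᵇ λ x → lookup S x ⇒ᵇ
             ((degree G x <ᵇ suc s) ∧ (∀ᵇ λ y → lookup S y ⇒ᵇ not (adj G x y)))

{-# OPTIONS --safe #-}
-- Upper bound. By Mader's argument graphs in 𝒢 have linearly many edges. The vertices of degree at most s in T are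
-- covered by α_s(T) vertices and edges (matched greedily from the leaves), and each of these has O(n) possible images.
-- Once the images of the low-degree vertices are fixed, only boundedly many extensions to the remaining set U exist:
-- t extensions with disjoint images of U would yield a K_{s+1,t} minor, because U contains a connected set with s+1
-- distinct neighbours outside U; hence boundedly many vertices of G meet all images of U, and one vertex of U is mapped
-- to one of them.
-- Lower bound. Replace each vertex of a maximum stable set of vertices of degree at most s by about n / |T| copies.
-- The neighbourhood of such a vertex together with one copy is a bag of size at most s+1.
module Submission where

open import Defs
open import Data.Nat using (ℕ; zero; suc; _+_; _*_; _^_; _≤_; _<_; _<ᵇ_; _⊔_; NonZero; >-nonZero; pred; z≤n; s≤s)
import Data.Nat.Properties as ℕ
open import Data.Nat.DivMod using (_/_; _%_; m%n<n; [m+kn]%n≡m%n; m<n⇒m%n≡m; m≥n⇒m/n>0; m/n*n≤m; m≡m%n+[m/n]*n)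
open import Data.Bool using (Bool; true; false; not; _∧_; _∨_)
import Data.Bool.Properties as 𝔹
open import Data.Empty using (⊥; ⊥-elim)
open import Data.Unit using (⊤; tt)
open import Data.Fin using (Fin; zero; suc; toℕ; inject₁; fromℕ)
import Data.Fin as Fin
import Data.Fin.Properties as Fin
open import Data.Fin.Subset using (Subset; ∣_∣)
import Data.Fin.Subset as Subset
import Data.Fin.Subset.Properties as Subset
open import Data.Vec using (Vec; []; _∷_; lookup)
import Data.Vec as Vec
import Data.Vec.Properties as Vec
open import Data.List using (List; []; _∷_; _++_; map; concatMap; length; filterᵇ; allFin)
import Data.List as List
import Data.List.Properties as List
open import Data.List.Extrema.Nat using (argmax; argmin; argmax-sel; argmin-sel; f[⊥]≤f[argmax]; f[xs]≤f[argmax]; f[argmin]≤f[xs])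
open import Data.List.Membership.Propositional using (_∈_; _∉_)
import Data.List.Membership.DecPropositional as DecMembership
import Data.List.Membership.Propositional as ∈
import Data.List.Membership.Propositional.Properties as ∈
open import Data.List.Relation.Unary.Any using (here; there)
import Data.List.Relation.Unary.Any as Any
import Data.List.Relation.Unary.Any.Properties as Any
open import Data.List.Relation.Unary.All using ([]; _∷_)
import Data.List.Relation.Unary.All as All
import Data.List.Relation.Unary.All.Properties as All
open import Data.List.Relation.Unary.AllPairs using ([]; _∷_)
open import Data.List.Relation.Unary.Unique.Propositional using (Unique)
import Data.List.Relation.Unary.Unique.Propositional.Properties as Unique
open import Data.Bool.ListAction using (all; any)
open import Data.Maybe using (Maybe; just; nothing)
import Data.Maybe as Maybe
import Data.Maybe.Properties as Maybe
open import Data.Product using (Σ; ∃; _×_; _,_; proj₁; proj₂)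
open import Data.Sum using (_⊎_; inj₁; inj₂)
open import Function using (_∘_; id; Equivalence)
open import Relation.Binary.PropositionalEquality using (_≡_; _≢_; refl; sym; trans; cong; cong₂; subst; subst₂)
open import Relation.Nullary using (¬_; Dec; yes; no; does)
open import Relation.Nullary.Decidable using (dec-true; _×-dec_; _→-dec_; _⊎-dec_; ¬?; map′)

-- Both bounds have the same exponent because of a min-max equality: in a forest, the vertices of
-- degree at most `s` contain a stable set that has exactly as many elements as some family of
-- vertices and edges covering all of them. Both are built in one pass, so neither has to be shown
-- optimal. The class `𝒢` is an arbitrary predicate, and membership in it is never decided. The
-- bound on edges is therefore an induction on the order of an excluded complete graph, in which the
-- predicate itself changes from `𝒢` to `𝒢 ∘ cone`; contraction is only needed as a map of vertex
-- sets with a section. `C` counts subgraphs, while the arguments handle embeddings. For the upper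
-- bound every copy is the image of at least one embedding, so automorphisms cost nothing. For the
-- lower bound the embeddings of one family are told apart by their vertex sets. A blow-up has to
-- have exactly `m` vertices. The vertices left over after equal distribution become further copies
-- of vertices of the stable set, which is therefore required to be nonempty; the empty forest is
-- treated apart.

private variable
  A A′ : Set

-- Boolean reflection, lists without repetition, and bounds by covering lists

∧⁻ : ∀ {a b} → a ∧ b ≡ true → a ≡ true × b ≡ true
∧⁻ {true} {true} refl = refl , refl

∧⁺ : ∀ {a b} → a ≡ true → b ≡ true → a ∧ b ≡ true
∧⁺ refl refl = refl

not⁻ : ∀ {a} → not a ≡ true → a ≢ true
not⁻ {false} _ ()

not⁺ : ∀ {a} → a ≢ true → not a ≡ true
not⁺ {false} _ = refl
not⁺ {true} h = ⊥-elim (h refl)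

bool-ext : ∀ {a b} → (a ≡ true → b ≡ true) → (b ≡ true → a ≡ true) → a ≡ b
bool-ext {false} {false} _ _ = refl
bool-ext {false} {true} _ g = g refl
bool-ext {true} {false} f _ = sym (f refl)
bool-ext {true} {true} _ _ = refl

⇒ᵇ⁻ : ∀ {a b} → a ⇒ᵇ b ≡ true → a ≡ true → b ≡ true
⇒ᵇ⁻ h refl = h

⇒ᵇ⁺ : ∀ {a b} → (a ≡ true → b ≡ true) → a ⇒ᵇ b ≡ true
⇒ᵇ⁺ {false} _ = refl
⇒ᵇ⁺ {true} h = h refl

⇔ᵇ⁻ : ∀ {a b} → a ⇔ᵇ b ≡ true → a ≡ b
⇔ᵇ⁻ {false} {false} _ = refl
⇔ᵇ⁻ {true} {true} _ = refl

⇔ᵇ⁺ : ∀ {a b} → a ≡ b → a ⇔ᵇ b ≡ true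
⇔ᵇ⁺ {false} refl = refl
⇔ᵇ⁺ {true} refl = refl

dec⁻ : {P : Set} (P? : Dec P) → does P? ≡ true → P
dec⁻ (yes p) _ = p

==⁻ : ∀ {k} {i j : Fin k} → (i == j) ≡ true → i ≡ j
==⁻ {i = i} {j} = dec⁻ (i Fin.≟ j)

==⁺ : ∀ {k} {i j : Fin k} → i ≡ j → (i == j) ≡ true
==⁺ {i = i} {j} = dec-true (i Fin.≟ j)

==-refl : ∀ {k} (i : Fin k) → (i == i) ≡ true
==-refl i = ==⁺ {i = i} refl

all⁻ : (p : A → Bool) {xs : List A} → all p xs ≡ true → ∀ {x} → x ∈ xs → p x ≡ true
all⁻ p h (here refl) = proj₁ (∧⁻ h)
all⁻ p {y ∷ _} h (there x∈) = all⁻ p (proj₂ (∧⁻ {p y} h)) x∈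

all⁺ : (p : A → Bool) (xs : List A) → (∀ {x} → x ∈ xs → p x ≡ true) → all p xs ≡ true
all⁺ p [] h = refl
all⁺ p (x ∷ xs) h = ∧⁺ (h (here refl)) (all⁺ p xs (h ∘ there))

any⁻ : (p : A → Bool) (xs : List A) → any p xs ≡ true → ∃ λ x → x ∈ xs × p x ≡ true
any⁻ p (x ∷ xs) h with p x in eq
... | true = x , here refl , eq
... | false with y , y∈ , py ← any⁻ p xs h = y , there y∈ , py

any⁺ : (p : A → Bool) {xs : List A} {x : A} → x ∈ xs → p x ≡ true → any p xs ≡ true
any⁺ p (here refl) px rewrite px = refl
any⁺ p {y ∷ _} (there x∈) px with p y
... | true = refl
... | false = any⁺ p x∈ px

∀ᵇ⁻ : ∀ {k} {p : Fin k → Bool} → ∀ᵇ p ≡ true → ∀ x → p x ≡ true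
∀ᵇ⁻ {p = p} h x = all⁻ p h (∈.∈-allFin x)

∀ᵇ⁺ : ∀ {k} {p : Fin k → Bool} → (∀ x → p x ≡ true) → ∀ᵇ p ≡ true
∀ᵇ⁺ {k} {p} h = all⁺ p (allFin k) (λ {x} _ → h x)

∃ᵇ⁻ : ∀ {k} {p : Fin k → Bool} → ∃ᵇ p ≡ true → ∃ λ x → p x ≡ true
∃ᵇ⁻ {k} {p} h with x , _ , px ← any⁻ p (allFin k) h = x , px

∃ᵇ⁺ : ∀ {k} {p : Fin k → Bool} x → p x ≡ true → ∃ᵇ p ≡ true
∃ᵇ⁺ {p = p} x = any⁺ p (∈.∈-allFin x)

∈-filterᵇ⁺ : (p : A → Bool) {xs : List A} {x : A} → x ∈ xs → p x ≡ true → x ∈ filterᵇ p xs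
∈-filterᵇ⁺ p x∈ px = ∈.∈-filter⁺ (λ x → 𝔹.T? (p x)) x∈ (Equivalence.from 𝔹.T-≡ px)

∈-filterᵇ⁻ : (p : A → Bool) {xs : List A} {x : A} → x ∈ filterᵇ p xs → x ∈ xs × p x ≡ true
∈-filterᵇ⁻ p {xs} x∈ with x∈′ , px ← ∈.∈-filter⁻ (λ x → 𝔹.T? (p x)) {xs = xs} x∈ =
  x∈′ , Equivalence.to 𝔹.T-≡ px

filterᵇ-unique : (p : A → Bool) {xs : List A} → Unique xs → Unique (filterᵇ p xs)
filterᵇ-unique p = Unique.filter⁺ (λ x → 𝔹.T? (p x))

∈-concatMap⁺ : (f : A → List A′) {xs : List A} {a : A} {b : A′} → a ∈ xs → b ∈ f a → b ∈ concatMap f xs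
∈-concatMap⁺ f {a ∷ _} (here refl) b∈ = ∈.∈-++⁺ˡ b∈
∈-concatMap⁺ f {a ∷ _} (there a∈) b∈ = ∈.∈-++⁺ʳ (f a) (∈-concatMap⁺ f a∈ b∈)

∈-concatMap⁻ : (f : A → List A′) (xs : List A) {b : A′} → b ∈ concatMap f xs → ∃ λ a → a ∈ xs × b ∈ f a
∈-concatMap⁻ f (x ∷ xs) b∈ with ∈.∈-++⁻ (f x) b∈
... | inj₁ b∈fx = x , here refl , b∈fx
... | inj₂ b∈′ with a , a∈ , b∈fa ← ∈-concatMap⁻ f xs b∈′ = a , there a∈ , b∈fa

-- `key` recovers from an element the block it belongs to, so different blocks are disjoint.
concatMap-unique : (f : A → List A′) (key : A′ → A) → (∀ {a b} → b ∈ f a → key b ≡ a) →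
  (∀ a → Unique (f a)) → {xs : List A} → Unique xs → Unique (concatMap f xs)
concatMap-unique f key keyed uf [] = []
concatMap-unique f key keyed uf {x ∷ xs} u@(_ ∷ us) =
  Unique.++⁺ (uf x) (concatMap-unique f key keyed uf us) λ (b∈fx , b∈) →
    let a , a∈ , b∈fa = ∈-concatMap⁻ f xs b∈
    in Unique.Unique[x∷xs]⇒x∉xs u (subst (_∈ xs) (trans (sym (keyed b∈fa)) (keyed b∈fx)) a∈)

length-concatMap-≤ : (f : A → List A′) {k : ℕ} → (∀ a → length (f a) ≤ k) → ∀ xs → length (concatMap f xs) ≤ length xs * k
length-concatMap-≤ f h [] = z≤n
length-concatMap-≤ f h (x ∷ xs) =
  ℕ.≤-trans (ℕ.≤-reflexive (List.length-++ (f x))) (ℕ.+-mono-≤ (h x) (length-concatMap-≤ f h xs))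

length-concatMap-≥ : (f : A → List A′) {k : ℕ} → (∀ a → k ≤ length (f a)) → ∀ xs → length xs * k ≤ length (concatMap f xs)
length-concatMap-≥ f h [] = z≤n
length-concatMap-≥ f h (x ∷ xs) =
  ℕ.≤-trans (ℕ.+-mono-≤ (h x) (length-concatMap-≥ f h xs)) (ℕ.≤-reflexive (sym (List.length-++ (f x))))

unique-⊆⇒length-≤ : {xs : List A} → Unique xs → (ys : List A) → (∀ {x} → x ∈ xs → x ∈ ys) → length xs ≤ length ys
unique-⊆⇒length-≤ [] ys _ = z≤n
unique-⊆⇒length-≤ {xs = x ∷ xs} u@(_ ∷ us) ys sub with l , r , refl ← ∈.∈-∃++ (sub (here refl)) =
  ℕ.≤-trans (s≤s (unique-⊆⇒length-≤ us (l ++ r) sub′)) (ℕ.≤-reflexive eq)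
  where
  sub′ : ∀ {y} → y ∈ xs → y ∈ l ++ r
  sub′ {y} y∈ with ∈.∈-++⁻ l (sub (there y∈))
  ... | inj₁ y∈l = ∈.∈-++⁺ˡ y∈l
  ... | inj₂ (here refl) = ⊥-elim (Unique.Unique[x∷xs]⇒x∉xs u y∈)
  ... | inj₂ (there y∈r) = ∈.∈-++⁺ʳ l y∈r
  eq : suc (length (l ++ r)) ≡ length (l ++ x ∷ r)
  eq = trans (cong suc (List.length-++ l)) (trans (sym (ℕ.+-suc (length l) (length r))) (sym (List.length-++ l)))

unique-lookup : {xs : List A} → Unique xs → ∀ {i j} → List.lookup xs i ≡ List.lookup xs j → i ≡ j
unique-lookup {xs = _ ∷ _} u {zero} {zero} _ = refl
unique-lookup {xs = _ ∷ xs} u {zero} {suc j} eq = ⊥-elim (Unique.Unique[x∷xs]⇒x∉xs u (subst (_∈ xs) (sym eq) (∈.∈-lookup j)))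
unique-lookup {xs = _ ∷ xs} u {suc i} {zero} eq = ⊥-elim (Unique.Unique[x∷xs]⇒x∉xs u (subst (_∈ xs) eq (∈.∈-lookup i)))
unique-lookup {xs = _ ∷ _} (_ ∷ us) {suc i} {suc j} eq = cong suc (unique-lookup us eq)

-- An upper bound on the number of solutions of `P` that asks neither for decidability of `P` nor
-- for a list free of repetitions or of other elements. Such bounds compose under unions and images;
-- `cover-length` turns them back into counts.
Cover : (A → Set) → ℕ → Set
Cover {A} P c = Σ (List A) λ L → length L ≤ c × (∀ {a} → P a → a ∈ L)

cover-⊆ : {P Q : A → Set} {c d : ℕ} → (∀ {a} → Q a → P a) → c ≤ d → Cover P c → Cover Q d
cover-⊆ q c≤d (L , len , all) = L , ℕ.≤-trans len c≤d , all ∘ q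

cover-⋃ : {I : Set} {P : I → A → Set} {c : ℕ} (is : List I) → (∀ {i} → i ∈ is → Cover (P i) c) →
  Cover (λ a → ∃ λ i → i ∈ is × P i a) (length is * c)
cover-⋃ [] _ = [] , z≤n , λ ()
cover-⋃ {A} {I} {P} (i ∷ is) h with L , len , cov ← h (here refl) | M , len′ , cov′ ← cover-⋃ {P = P} is (h ∘ there) =
  L ++ M , ℕ.≤-trans (ℕ.≤-reflexive (List.length-++ L)) (ℕ.+-mono-≤ len len′) , go
  where
  go : ∀ {a} → (∃ λ j → j ∈ i ∷ is × P j a) → a ∈ L ++ M
  go (j , here refl , p) = ∈.∈-++⁺ˡ (cov p)
  go (j , there j∈ , p) = ∈.∈-++⁺ʳ L (cov′ (j , j∈ , p))

cover-map : {P : A → Set} {c : ℕ} (f : A → A′) → Cover P c → Cover (λ b → ∃ λ a → P a × b ≡ f a) c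
cover-map f (L , len , cov) = map f L , ℕ.≤-trans (ℕ.≤-reflexive (List.length-map f L)) len ,
  λ { (a , p , refl) → ∈.∈-map⁺ f (cov p) }

cover-length : {P : A → Set} {c : ℕ} → Cover P c → {xs : List A} → Unique xs → (∀ {x} → x ∈ xs → P x) → length xs ≤ c
cover-length (L , len , cov) u h = ℕ.≤-trans (unique-⊆⇒length-≤ u L (cov ∘ h)) len

∈-allVecs : {xs : List A} {k : ℕ} (v : Vec A k) → (∀ i → lookup v i ∈ xs) → v ∈ allVecs xs k
∈-allVecs [] _ = here refl
∈-allVecs (x ∷ v) h = ∈-concatMap⁺ _ (∈-allVecs v (h ∘ suc)) (∈.∈-map⁺ (_∷ v) (h zero))

allVecs-unique : {xs : List A} (k : ℕ) → Unique xs → Unique (allVecs xs k)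
allVecs-unique zero _ = [] ∷ []
allVecs-unique {xs = xs} (suc k) u = concatMap-unique (λ v → map (_∷ v) xs) Vec.tail
  (λ b∈ → let _ , _ , eq = ∈.∈-map⁻ _ b∈ in cong Vec.tail eq)
  (λ v → Unique.map⁺ (cong Vec.head) u) (allVecs-unique k u)

lookup-ext : {k : ℕ} {v w : Vec A k} → (∀ i → lookup v i ≡ lookup w i) → v ≡ w
lookup-ext {v = []} {[]} _ = refl
lookup-ext {v = _ ∷ _} {_ ∷ _} h = cong₂ _∷_ (h zero) (lookup-ext (h ∘ suc))

-- Membership is up to pointwise equality: without function extensionality `g` itself need not be in
-- the list.
∈-allFuns : (m k : ℕ) (g : Fin m → Fin k) → ∃ λ f → f ∈ allFuns m k × (∀ i → f i ≡ g i)
∈-allFuns zero k g = _ , here refl , λ ()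
∈-allFuns (suc m) k g with f , f∈ , eq ← ∈-allFuns m k (g ∘ suc) =
  _ , ∈-concatMap⁺ _ f∈ (∈.∈-map⁺ _ (∈.∈-allFin (g zero))) , λ { zero → refl ; (suc i) → eq i }

elems : ∀ {k} → Subset k → List (Fin k)
elems [] = []
elems (true ∷ S) = zero ∷ map suc (elems S)
elems (false ∷ S) = map suc (elems S)

length-elems : ∀ {k} (S : Subset k) → length (elems S) ≡ ∣ S ∣
length-elems [] = refl
length-elems (true ∷ S) = cong suc (trans (List.length-map suc (elems S)) (length-elems S))
length-elems (false ∷ S) = trans (List.length-map suc (elems S)) (length-elems S)

∈-elems⁺ : ∀ {k} (S : Subset k) {x} → lookup S x ≡ true → x ∈ elems S
∈-elems⁺ (true ∷ S) {zero} h = here refl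
∈-elems⁺ (true ∷ S) {suc x} h = there (∈.∈-map⁺ suc (∈-elems⁺ S h))
∈-elems⁺ (false ∷ S) {suc x} h = ∈.∈-map⁺ suc (∈-elems⁺ S h)

∈-elems⁻ : ∀ {k} (S : Subset k) {x} → x ∈ elems S → lookup S x ≡ true
∈-elems⁻ (true ∷ S) (here refl) = refl
∈-elems⁻ (true ∷ S) (there x∈) with _ , y∈ , refl ← ∈.∈-map⁻ suc x∈ = ∈-elems⁻ S y∈
∈-elems⁻ (false ∷ S) x∈ with _ , y∈ , refl ← ∈.∈-map⁻ suc x∈ = ∈-elems⁻ S y∈

elems-unique : ∀ {k} (S : Subset k) → Unique (elems S)
elems-unique [] = []
elems-unique (true ∷ S) = All.map⁺ (All.universal (λ _ ()) _) ∷ Unique.map⁺ Fin.suc-injective (elems-unique S)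
elems-unique (false ∷ S) = Unique.map⁺ Fin.suc-injective (elems-unique S)

∣S∣≤length : ∀ {k} (S : Subset k) (L : List (Fin k)) → (∀ {x} → lookup S x ≡ true → x ∈ L) → ∣ S ∣ ≤ length L
∣S∣≤length S L h = ℕ.≤-trans (ℕ.≤-reflexive (sym (length-elems S)))
  (unique-⊆⇒length-≤ (elems-unique S) L (h ∘ ∈-elems⁻ S))

length≤∣S∣ : ∀ {k} (S : Subset k) {L : List (Fin k)} → Unique L → (∀ {x} → x ∈ L → lookup S x ≡ true) → length L ≤ ∣ S ∣
length≤∣S∣ S u h = ℕ.≤-trans (unique-⊆⇒length-≤ u (elems S) (∈-elems⁺ S ∘ h)) (ℕ.≤-reflexive (length-elems S))

-- Minors

walk-hom : {G H : Graph} {P : V G → Set} {Q : V H → Set} (f : V G → V H) →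
  (∀ {x y} → adj G x y ≡ true → adj H (f x) (f y) ≡ true) → (∀ {x} → P x → Q (f x)) →
  ∀ {x y} → WalkIn G P x y → WalkIn H Q (f x) (f y)
walk-hom f hom imp (here p) = here (imp p)
walk-hom f hom imp (step p e w) = step (imp p) (hom e) (walk-hom f hom imp w)

walk-++ : {G : Graph} {P : V G → Set} {x y z : V G} → WalkIn G P x y → WalkIn G P y z → WalkIn G P x z
walk-++ (here _) w′ = w′
walk-++ (step p e w) w′ = step p e (walk-++ w w′)

walk-start : {G : Graph} {P : V G → Set} {x y : V G} → WalkIn G P x y → P x
walk-start (here p) = p
walk-start (step p _ _) = p

walk-reverse : {G : Graph} {P : V G → Set} {x y : V G} → WalkIn G P x y → WalkIn G P y x
walk-reverse (here p) = here p
walk-reverse {G} (step {x} {y} p e w) =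
  walk-++ (walk-reverse w) (step (walk-start w) (trans (adj-sym G y x) e) (here p))

module _ {H G : Graph} (B : V H → V G → Set) (B? : ∀ v x → Dec (B v x))
  (disjoint : ∀ {u v x} → B u x → B v x → u ≡ v)
  (rooted : ∀ v → ∃ λ r → B v r × (∀ {x} → B v x → WalkIn G (B v) r x))
  (edge : ∀ u v → adj H u v ≡ true → ∃ λ x → ∃ λ y → B u x × B v y × adj G x y ≡ true) where

  private
    β : V G → Maybe (V H)
    β x with Fin.any? (λ v → B? v x)
    ... | yes (v , _) = just v
    ... | no _ = nothing

    β⁻ : ∀ {x v} → β x ≡ just v → B v x
    β⁻ {x} eq with Fin.any? (λ v → B? v x)
    β⁻ refl | yes (_ , b) = b

    β⁺ : ∀ {x v} → B v x → β x ≡ just v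
    β⁺ {x} {v} b with Fin.any? (λ v → B? v x)
    ... | yes (_ , b′) = cong just (disjoint b′ b)
    ... | no ¬b = ⊥-elim (¬b (v , b))

  -- `β` searches for the branch set containing a vertex, and disjointness makes the answer unique.
  -- Walks from one root suffice, since two of them can be joined at the root.
  branch-sets⇒minor : Minor H G
  branch-sets⇒minor = record
    { β = β
    ; nonempty = λ v → let r , b , _ = rooted v in r , β⁺ b
    ; connected = λ v x y ex ey → let r , _ , w = rooted v in
        walk-hom id id β⁺ (walk-++ (walk-reverse (w (β⁻ ex))) (w (β⁻ ey)))
    ; edges = λ u v e → let x , y , bu , bv , e′ = edge u v e in x , y , β⁺ bu , β⁺ bv , e′
    }

embedding⇒minor : {H G : Graph} (f : V H → V G) → (∀ {u v} → f u ≡ f v → u ≡ v) →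
  (∀ {u v} → adj H u v ≡ true → adj G (f u) (f v) ≡ true) → Minor H G
embedding⇒minor f inj hom = branch-sets⇒minor (λ v x → f v ≡ x) (λ v x → f v Fin.≟ x)
  (λ { p refl → inj p }) (λ v → f v , refl , λ { refl → here refl })
  (λ u v e → f u , f v , refl , refl , hom e)

-- For injective `f` this is an induced subgraph. For other `f` it is a blow-up, in which vertices
-- with the same image are not adjacent.
pull : (G : Graph) {k : ℕ} → (Fin k → V G) → Graph
pull G f = record
  { adj = λ i j → adj G (f i) (f j)
  ; adj-sym = λ i j → adj-sym G (f i) (f j)
  ; adj-irr = λ i → adj-irr G (f i)
  }

cone : Graph → Graph
cone H = record { n = suc (n H) ; adj = a ; adj-sym = s ; adj-irr = irr }
  where
  a : Fin (suc (n H)) → Fin (suc (n H)) → Bool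
  a zero zero = false
  a zero (suc _) = true
  a (suc _) zero = true
  a (suc i) (suc j) = adj H i j
  s : ∀ i j → a i j ≡ a j i
  s zero zero = refl
  s zero (suc _) = refl
  s (suc _) zero = refl
  s (suc i) (suc j) = adj-sym H i j
  irr : ∀ i → a i i ≡ false
  irr zero = refl
  irr (suc i) = adj-irr H i

-- With the apex as its own branch set, this makes `𝒢 ∘ cone` closed under minors whenever `𝒢` is.
cone-minor : {H G : Graph} → Minor H G → Minor (cone H) (cone G)
cone-minor {H} {G} M = branch-sets⇒minor B B? disjoint rooted edge
  where
  open Minor M
  B : V (cone H) → V (cone G) → Set
  B zero zero = ⊤
  B zero (suc _) = ⊥
  B (suc _) zero = ⊥
  B (suc v) (suc x) = β x ≡ just v
  B? : ∀ v x → Dec (B v x)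
  B? zero zero = yes tt
  B? zero (suc _) = no id
  B? (suc _) zero = no id
  B? (suc v) (suc x) = Maybe.≡-dec Fin._≟_ (β x) (just v)
  disjoint : ∀ {u v x} → B u x → B v x → u ≡ v
  disjoint {zero} {zero} {zero} _ _ = refl
  disjoint {suc u} {suc v} {suc x} p q = cong suc (Maybe.just-injective (trans (sym p) q))
  rooted : ∀ v → ∃ λ r → B v r × (∀ {x} → B v x → WalkIn (cone G) (B v) r x)
  rooted zero = zero , tt , λ { {zero} _ → here tt }
  rooted (suc v) with r , b ← nonempty v = suc r , b , λ { {suc x} b′ → walk-hom suc id id (connected v r x b b′) }
  edge : ∀ u v → adj (cone H) u v ≡ true → ∃ λ x → ∃ λ y → B u x × B v y × adj (cone G) x y ≡ true
  edge zero (suc v) _ with x , b ← nonempty v = zero , suc x , tt , b , refl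
  edge (suc v) zero _ with x , b ← nonempty v = suc x , zero , b , tt , refl
  edge (suc u) (suc v) e with x , y , bu , bv , e′ ← edges u v e = suc x , suc y , bu , bv , e′

-- As iterated cones, `𝒢 (Complete (suc k))` and `(𝒢 ∘ cone) (Complete k)` are the same type, which
-- is the form the induction in `linear-edges` needs.
Complete : ℕ → Graph
Complete zero = record { n = 0 ; adj = λ () ; adj-sym = λ () ; adj-irr = λ () }
Complete (suc k) = cone (Complete k)

n-Complete : ∀ k → n (Complete k) ≡ k
n-Complete zero = refl
n-Complete (suc k) = cong suc (n-Complete k)

adj-Complete : ∀ k {i j} → i ≢ j → adj (Complete k) i j ≡ true
adj-Complete (suc k) {zero} {zero} i≢j = ⊥-elim (i≢j refl)
adj-Complete (suc k) {zero} {suc j} _ = refl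
adj-Complete (suc k) {suc i} {zero} _ = refl
adj-Complete (suc k) {suc i} {suc j} i≢j = adj-Complete k (i≢j ∘ cong suc)

adj⇒≢ : (G : Graph) {x y : V G} → adj G x y ≡ true → x ≢ y
adj⇒≢ G {x} e refl with () ← trans (sym (adj-irr G x)) e

minor-Complete : (H : Graph) → Minor H (Complete (n H))
minor-Complete H = embedding⇒minor (Fin.cast (sym (n-Complete (n H))))
  (λ eq → Fin.toℕ-injective (trans (sym (Fin.toℕ-cast _ _)) (trans (cong toℕ eq) (Fin.toℕ-cast _ _))))
  (λ {u} {v} e → adj-Complete (n H) λ eq → adj⇒≢ H e
    (Fin.toℕ-injective (trans (sym (Fin.toℕ-cast _ u)) (trans (cong toℕ eq) (Fin.toℕ-cast _ v)))))

-- Linearly many edges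

Adj : (G : Graph) → V G × V G → Set
Adj G (u , v) = adj G u v ≡ true

private
  edge-between : (G : Graph) {m : ℕ} → (V G → Fin m) → Fin m → Fin m → Bool
  edge-between G ρ i j = ∃ᵇ λ a → ∃ᵇ λ b → (ρ a == i) ∧ (ρ b == j) ∧ adj G a b

  edge-between⁻ : (G : Graph) {m : ℕ} (ρ : V G → Fin m) {i j : Fin m} → edge-between G ρ i j ≡ true →
    ∃ λ a → ∃ λ b → ρ a ≡ i × ρ b ≡ j × adj G a b ≡ true
  edge-between⁻ G ρ {i} {j} h with a , h ← ∃ᵇ⁻ h with b , h ← ∃ᵇ⁻ h =
    let p , h = ∧⁻ {ρ a == i} h ; q , h = ∧⁻ {ρ b == j} h in a , b , ==⁻ p , ==⁻ q , h

  edge-between⁺ : (G : Graph) {m : ℕ} (ρ : V G → Fin m) {a b : V G} → adj G a b ≡ true →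
    edge-between G ρ (ρ a) (ρ b) ≡ true
  edge-between⁺ G ρ {a} {b} e = ∃ᵇ⁺ a (∃ᵇ⁺ b (∧⁺ (==-refl (ρ a)) (∧⁺ (==-refl (ρ b)) e)))

  edge-between-swap : (G : Graph) {m : ℕ} (ρ : V G → Fin m) {i j : Fin m} →
    edge-between G ρ i j ≡ true → edge-between G ρ j i ≡ true
  edge-between-swap G ρ h with a , b , refl , refl , e ← edge-between⁻ G ρ h =
    edge-between⁺ G ρ (trans (adj-sym G b a) e)

quotient : (G : Graph) {m : ℕ} → (V G → Fin m) → Graph
quotient G ρ = record
  { adj = λ i j → not (i == j) ∧ edge-between G ρ i j
  ; adj-sym = λ i j → bool-ext (swap {i} {j}) (swap {j} {i})
  ; adj-irr = λ i → cong (λ b → not b ∧ edge-between G ρ i i) (==-refl i)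
  }
  where
  swap : ∀ {i j} → not (i == j) ∧ edge-between G ρ i j ≡ true → not (j == i) ∧ edge-between G ρ j i ≡ true
  swap {i} {j} h with p , q ← ∧⁻ {not (i == j)} h =
    ∧⁺ (not⁺ (λ eq → not⁻ {i == j} p (==⁺ (sym (==⁻ {i = j} eq))))) (edge-between-swap G ρ q)

common : (G : Graph) → V G → V G → List (V G)
common G x y = filterᵇ (λ z → adj G x z ∧ adj G y z) (allFin (n G))

-- Undoes the contraction of xy on edges: an edge of the quotient at x that is not an edge of G comes from y.
unmerge : (G : Graph) (x y a b : V G) → V G × V G
unmerge G x y a b with adj G a b | a Fin.≟ x
... | true | _ = a , b
... | false | yes _ = y , b
... | false | no _ = a , y

unmerge-edge : (G : Graph) (x y : V G) {a b : V G} → adj G a b ≡ true → unmerge G x y a b ≡ (a , b)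
unmerge-edge G x y e rewrite e = refl

unmerge-left : (G : Graph) (x y : V G) {b : V G} → adj G x b ≡ false → unmerge G x y x b ≡ (y , b)
unmerge-left G x y e with x Fin.≟ x
... | yes _ rewrite e = refl
... | no x≢x = ⊥-elim (x≢x refl)

unmerge-right : (G : Graph) (x y : V G) {a b : V G} → a ≢ x → adj G a b ≡ false → unmerge G x y a b ≡ (a , y)
unmerge-right G x y {a} a≢x e with a Fin.≟ x
... | yes a≡x = ⊥-elim (a≢x a≡x)
... | no _ rewrite e = refl

-- `ρ` identifies `y` with `x`, and `σ` is a section of it that picks `x` for the merged vertex.
-- Keeping both abstract confines the renumbering of vertices to `retraction`.
module Contraction (G : Graph) {m : ℕ} (x y : V G) (xy : adj G x y ≡ true)
  (ρ : V G → Fin m) (σ : Fin m → V G) (ρσ : ∀ i → ρ (σ i) ≡ i)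
  (σρ : ∀ {z} → y ≢ z → σ (ρ z) ≡ z) (σρy : σ (ρ y) ≡ x) where

  private
    H = quotient G ρ

    ρx≡ρy : ρ x ≡ ρ y
    ρx≡ρy = trans (sym (cong ρ σρy)) (ρσ (ρ y))

    fibre-walk : ∀ {v z} → ρ z ≡ v → WalkIn G (λ w → ρ w ≡ v) (σ v) z
    fibre-walk {z = z} refl with y Fin.≟ z
    ... | no y≢z rewrite σρ y≢z = here refl
    ... | yes refl rewrite σρy = step ρx≡ρy xy (here refl)

  minor : Minor H G
  minor = branch-sets⇒minor (λ v z → ρ z ≡ v) (λ v z → ρ z Fin.≟ v) (λ p q → trans (sym p) q)
    (λ v → σ v , ρσ v , fibre-walk)
    (λ u v e → edge-between⁻ G ρ (proj₂ (∧⁻ {not (u == v)} e)))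

  private
    lift : V H × V H → V G × V G
    lift (i , j) = unmerge G x y (σ i) (σ j)

    Lifted : V G × V G → Set
    Lifted e = ∃ λ e′ → Adj H e′ × e ≡ lift e′

    AtEdge : V G × V G → Set
    AtEdge e = e ∈ (x , y) ∷ (y , x) ∷ map (y ,_) (common G x y) ++ map (_, y) (common G x y)

    H-edge : ∀ {a b} → adj G a b ≡ true → ρ a ≢ ρ b → Adj H (ρ a , ρ b)
    H-edge e ne = ∧⁺ (not⁺ (ne ∘ ==⁻)) (edge-between⁺ G ρ e)

    ρ-injective : ∀ {a b} → y ≢ a → y ≢ b → ρ a ≡ ρ b → a ≡ b
    ρ-injective ya yb eq = trans (sym (σρ ya)) (trans (cong σ eq) (σρ yb))

    ∈-common : ∀ {z} → adj G x z ≡ true → adj G y z ≡ true → z ∈ common G x y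
    ∈-common {z} xz yz = ∈-filterᵇ⁺ _ (∈.∈-allFin z) (∧⁺ xz yz)

    at-y : ∀ {b} → adj G y b ≡ true → Lifted (y , b) ⊎ AtEdge (y , b)
    at-y {b} e with b Fin.≟ x | adj G x b in xb
    ... | yes refl | _ = inj₂ (there (here refl))
    ... | no b≢x | true = inj₂ (there (there (∈.∈-++⁺ˡ (∈.∈-map⁺ (y ,_) (∈-common xb e)))))
    ... | no b≢x | false = inj₁ ((ρ y , ρ b) , H-edge e ne , eq)
      where
      y≢b = adj⇒≢ G e
      ne : ρ y ≢ ρ b
      ne p = b≢x (ρ-injective y≢b (adj⇒≢ G xy ∘ sym) (trans (sym p) (sym ρx≡ρy)))
      eq : (y , b) ≡ lift (ρ y , ρ b)
      eq = sym (trans (cong₂ (unmerge G x y) σρy (σρ y≢b)) (unmerge-left G x y xb))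

    to-y : ∀ {a} → adj G a y ≡ true → Lifted (a , y) ⊎ AtEdge (a , y)
    to-y {a} e with a Fin.≟ x | adj G a x in ax
    ... | yes refl | _ = inj₂ (here refl)
    ... | no a≢x | true = inj₂ (there (there (∈.∈-++⁺ʳ (map (y ,_) _)
            (∈.∈-map⁺ (_, y) (∈-common (trans (adj-sym G x a) ax) (trans (adj-sym G y a) e))))))
    ... | no a≢x | false = inj₁ ((ρ a , ρ y) , H-edge e ne , eq)
      where
      y≢a = adj⇒≢ G e ∘ sym
      ne : ρ a ≢ ρ y
      ne p = a≢x (ρ-injective y≢a (adj⇒≢ G xy ∘ sym) (trans p (sym ρx≡ρy)))
      eq : (a , y) ≡ lift (ρ a , ρ y)
      eq = sym (trans (cong₂ (unmerge G x y) (σρ y≢a) σρy) (unmerge-right G x y a≢x ax))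

    classify : ∀ {a b} → adj G a b ≡ true → Lifted (a , b) ⊎ AtEdge (a , b)
    classify {a} {b} e with y Fin.≟ a | y Fin.≟ b
    ... | yes refl | _ = at-y e
    ... | no _ | yes refl = to-y e
    ... | no y≢a | no y≢b = inj₁ ((ρ a , ρ b) , H-edge e (adj⇒≢ G e ∘ ρ-injective y≢a y≢b) , eq)
      where
      eq : (a , b) ≡ lift (ρ a , ρ b)
      eq = sym (trans (cong₂ (unmerge G x y) (σρ y≢a) (σρ y≢b)) (unmerge-edge G x y e))

  -- Edges are ordered pairs here. Contracting `xy` loses both orientations of `xy` and, for each
  -- common neighbour, both orientations of its edge to `y`; every other edge is `lift` of an edge
  -- of the quotient.
  cover-edges : ∀ {c d} → Cover (Adj H) d → length (common G x y) ≤ c → Cover (Adj G) (2 + (c + c) + d)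
  cover-edges {c} {d} (L , len , cov) small = at ++ map lift L , len′ , λ e → go (classify e)
    where
    cs = common G x y
    at = (x , y) ∷ (y , x) ∷ map (y ,_) cs ++ map (_, y) cs
    go : ∀ {e} → Lifted e ⊎ AtEdge e → e ∈ at ++ map lift L
    go (inj₁ (_ , h , refl)) = ∈.∈-++⁺ʳ at (∈.∈-map⁺ lift (cov h))
    go (inj₂ h) = ∈.∈-++⁺ˡ h
    len′ : length (at ++ map lift L) ≤ 2 + (c + c) + d
    len′ rewrite List.length-++ at {map lift L} | List.length-++ (map (y ,_) cs) {map (_, y) cs}
      | List.length-map (y ,_) cs | List.length-map (_, y) cs | List.length-map lift L =
      ℕ.+-mono-≤ (ℕ.+-monoʳ-≤ 2 (ℕ.+-mono-≤ small small)) len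

retraction : ∀ {k m} → k ≡ suc m → (x y : Fin k) → y ≢ x →
  ∃ λ (ρ : Fin k → Fin m) → ∃ λ (σ : Fin m → Fin k) →
    (∀ i → ρ (σ i) ≡ i) × (∀ {z} → y ≢ z → σ (ρ z) ≡ z) × σ (ρ y) ≡ x
retraction {m = m} refl x y y≢x = ρ , σ , ρσ , σρ , σρy
  where
  σ = Fin.punchIn y
  ρ : Fin (suc m) → Fin m
  ρ z with y Fin.≟ z
  ... | yes _ = Fin.punchOut y≢x
  ... | no y≢z = Fin.punchOut y≢z
  ρσ : ∀ i → ρ (σ i) ≡ i
  ρσ i with y Fin.≟ σ i
  ... | yes eq = ⊥-elim (Fin.punchInᵢ≢i y i (sym eq))
  ... | no y≢ = trans (Fin.punchOut-cong y refl) (Fin.punchOut-punchIn y)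
  σρ : ∀ {z} → y ≢ z → σ (ρ z) ≡ z
  σρ {z} y≢z with y Fin.≟ z
  ... | yes eq = ⊥-elim (y≢z eq)
  ... | no y≢z = Fin.punchIn-punchOut y≢z
  σρy : σ (ρ y) ≡ x
  σρy with y Fin.≟ y
  ... | yes _ = Fin.punchIn-punchOut y≢x
  ... | no y≢y = ⊥-elim (y≢y refl)

neighbours : (G : Graph) → V G → List (V G)
neighbours G v = filterᵇ (adj G v) (allFin (n G))

neighbours⁺ : (G : Graph) {v w : V G} → adj G v w ≡ true → w ∈ neighbours G v
neighbours⁺ G {v} {w} e = ∈-filterᵇ⁺ (adj G v) (∈.∈-allFin w) e

neighbours⁻ : (G : Graph) {v w : V G} → w ∈ neighbours G v → adj G v w ≡ true
neighbours⁻ G {v} w∈ = proj₂ (∈-filterᵇ⁻ (adj G v) {allFin (n G)} w∈)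

neighbours-unique : (G : Graph) (v : V G) → Unique (neighbours G v)
neighbours-unique G v = filterᵇ-unique (adj G v) (Unique.allFin⁺ (n G))

-- `Adj` consists of ordered pairs, so grouping them by first entry adds up the degrees without a
-- factor 2.
min-degree⇒many-edges : (G : Graph) (d : ℕ) → (∀ v → d ≤ degree G v) → ∀ {c} → Cover (Adj G) c → n G * d ≤ c
min-degree⇒many-edges G d deg {c} cov = begin
  n G * d                                ≡⟨ cong (_* d) (sym (List.length-tabulate {n = n G} id)) ⟩
  length (allFin (n G)) * d              ≤⟨ length-concatMap-≥ out many (allFin (n G)) ⟩
  length (concatMap out (allFin (n G)))  ≤⟨ cover-length cov unique edges ⟩
  c                                      ∎
  where
  open ℕ.≤-Reasoning
  out : V G → List (V G × V G)
  out v = map (v ,_) (neighbours G v)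
  many : ∀ v → d ≤ length (out v)
  many v = ℕ.≤-trans (deg v) (ℕ.≤-reflexive (sym (List.length-map (v ,_) (neighbours G v))))
  keyed : ∀ {v e} → e ∈ out v → proj₁ e ≡ v
  keyed {v} e∈ with _ , _ , refl ← ∈.∈-map⁻ (v ,_) e∈ = refl
  unique : Unique (concatMap out (allFin (n G)))
  unique = concatMap-unique out proj₁ keyed (λ v → Unique.map⁺ (cong proj₂) (neighbours-unique G v)) (Unique.allFin⁺ (n G))
  edges : ∀ {e} → e ∈ concatMap out (allFin (n G)) → Adj G e
  edges e∈ with v , _ , e∈out ← ∈-concatMap⁻ out (allFin (n G)) e∈
    with w , w∈ , refl ← ∈.∈-map⁻ (v ,_) e∈out = neighbours⁻ G w∈

module Link (G : Graph) (v : V G) where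

  private
    N = neighbours G v
    f : Fin (length N) → V G
    f = List.lookup N

  link : Graph
  link = pull G f

  private
    v~f : ∀ i → adj G v (f i) ≡ true
    v~f i = neighbours⁻ G (∈.∈-lookup i)

  -- With `v` as apex, this puts the link into `𝒢 ∘ cone`, where the induction hypothesis of
  -- `linear-edges` bounds its edges.
  cone-link-minor : Minor (cone link) G
  cone-link-minor = embedding⇒minor g inj (λ {i} {j} → hom {i} {j})
    where
    g : Fin (suc (length N)) → V G
    g zero = v
    g (suc i) = f i
    inj : ∀ {i j} → g i ≡ g j → i ≡ j
    inj {zero} {zero} _ = refl
    inj {zero} {suc j} eq = ⊥-elim (adj⇒≢ G (v~f j) eq)
    inj {suc i} {zero} eq = ⊥-elim (adj⇒≢ G (v~f i) (sym eq))
    inj {suc i} {suc j} eq = cong suc (unique-lookup (neighbours-unique G v) eq)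
    hom : ∀ {i j} → adj (cone link) i j ≡ true → adj G (g i) (g j) ≡ true
    hom {zero} {suc j} _ = v~f j
    hom {suc i} {zero} _ = trans (adj-sym G (f i) v) (v~f i)
    hom {suc i} {suc j} e = e

  -- A triangle on the edge from `v` to `f i` is an edge of the link at `i`. Edges in many triangles
  -- thus force a large minimum degree in the link.
  common≤degree : ∀ i → length (common G v (f i)) ≤ degree link i
  common≤degree i = ℕ.≤-trans
    (unique-⊆⇒length-≤ (filterᵇ-unique _ (Unique.allFin⁺ (n G))) (map f (neighbours link i)) sub)
    (ℕ.≤-reflexive (List.length-map f (neighbours link i)))
    where
    sub : ∀ {z} → z ∈ common G v (f i) → z ∈ map f (neighbours link i)
    sub {z} z∈ with _ , h ← ∈-filterᵇ⁻ (λ z → adj G v z ∧ adj G (f i) z) {allFin (n G)} z∈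
      with vz , iz ← ∧⁻ {adj G v z} h
      = subst (_∈ map f (neighbours link i)) (sym (Any.lookup-index z∈N))
          (∈.∈-map⁺ f (neighbours⁺ link (subst (λ w → adj G (f i) w ≡ true) (Any.lookup-index z∈N) iz)))
      where z∈N = neighbours⁺ G vz

-- Mader's argument: the link of a vertex of a 𝒢-graph lies in the class of graphs whose cone is in 𝒢, which excludes
-- the next smaller complete graph. So if every edge lies in many triangles, the links are too dense, and otherwise
-- contracting an edge in few triangles loses few edges.
linear-edges : (k : ℕ) (𝒢 : Graph → Set) → (∀ G H → 𝒢 G → Minor H G → 𝒢 H) → ¬ 𝒢 (Complete k) →
  ∃ λ c → ∀ G → 𝒢 G → Cover (Adj G) (c * n G)
linear-edges zero 𝒢 closed ∉𝒢 = 0 , λ G g →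
  ⊥-elim (∉𝒢 (closed G (Complete 0) g (embedding⇒minor (λ ()) (λ {}) (λ {}))))
linear-edges (suc k) 𝒢 closed ∉𝒢
  with c , ih ← linear-edges k (𝒢 ∘ cone) (λ G H g M → closed _ _ g (cone-minor M)) ∉𝒢
  = 2 + (c + c) , λ G → go (n G) G refl
  where
  go : ∀ m G → n G ≡ m → 𝒢 G → Cover (Adj G) ((2 + (c + c)) * n G)
  go zero G eq g = [] , z≤n , λ { {u , _} _ → ⊥-elim (Fin.¬Fin0 (subst Fin eq u)) }
  go (suc m) G eq g
    with Fin.any? (λ x → Fin.any? (λ y → (adj G x y 𝔹.≟ true) ×-dec (length (common G x y) ℕ.≤? c)))
  ... | yes (x , y , xy , small)
    with ρ , σ , ρσ , σρ , σρy ← retraction eq x y (adj⇒≢ G xy ∘ sym)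
    = cover-⊆ id (ℕ.≤-reflexive (sym (trans (cong ((2 + (c + c)) *_) eq) (ℕ.*-suc (2 + (c + c)) m))))
        (cover-edges {c} (go m _ refl (closed _ _ g minor)) small)
    where open Contraction G x y xy ρ σ ρσ σρ σρy
  -- The empty list suffices, as there is no edge at all: the link of an end of an edge would be
  -- nonempty, of minimum degree above `c`, and yet have at most `c` ordered edges per vertex.
  ... | no dense = [] , z≤n , λ { {v , w} e → ⊥-elim (too-dense v w e) }
    where
    too-dense : ∀ v w → adj G v w ≢ true
    too-dense v w e = ℕ.<⇒≱ d>0 (ℕ.+-cancelʳ-≤ (c * d) d 0 (ℕ.≤-trans (ℕ.≤-reflexive eq′) many))
      where
      open Link G v
      d = n link
      d>0 : 0 < d
      d>0 = ∈.∈-length (neighbours⁺ G e)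
      many : d * suc c ≤ c * d
      many = min-degree⇒many-edges link (suc c)
        (λ i → ℕ.≤-trans (ℕ.≰⇒> (λ le → dense (v , _ , neighbours⁻ G (∈.∈-lookup i) , le))) (common≤degree i))
        (ih link (closed _ _ g cone-link-minor))
      eq′ : d + c * d ≡ d * suc c
      eq′ = trans (cong (d +_) (ℕ.*-comm c d)) (sym (ℕ.*-suc d c))

-- Rooting a forest

-- `rank` need not be the depth. It only has to decrease towards parents, and its bound by `n G`
-- limits every descent through children.
record Rooting (G : Graph) : Set where
  field
    parent : V G → Maybe (V G)
    rank : V G → ℕ
    rank<n : ∀ v → rank v < n G
    parent-adj : ∀ {v p} → parent v ≡ just p → adj G v p ≡ true
    parent-rank : ∀ {v p} → parent v ≡ just p → rank p < rank v
    edge : ∀ {u v} → adj G u v ≡ true → parent u ≡ just v ⊎ parent v ≡ just u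

pull-forest : {G : Graph} {k : ℕ} {f : Fin k → V G} → (∀ {i j} → f i ≡ f j → i ≡ j) → Forest G → Forest (pull G f)
pull-forest {f = f} inj forest (l , c , c-inj , steps , close) = forest (l , f ∘ c , c-inj ∘ inj , steps , close)

module _ (G : Graph) (branching : ∀ v p → ∃ λ w → adj G v w ≡ true × w ≢ p) (forest : Forest G) where

  private
    Path : ℕ → Set
    Path k = ∃ λ (p : Fin (suc k) → V G) → (∀ {i j} → p i ≡ p j → i ≡ j) ×
      (∀ (i : Fin k) → adj G (p (inject₁ i)) (p (suc i)) ≡ true)

    second : ∀ {k} → (Fin (suc k) → V G) → V G
    -- A dummy value for the path on one vertex: no neighbour of `p zero` equals `p zero` anyway.
    second {zero} p = p zero
    second {suc _} p = p (suc zero)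

    -- If `w` were `p j` with `j` at least 2, the segment of the path from `p zero` to `p j` would
    -- close up to a cycle. Irreflexivity and `w ≢ second p` exclude the first two positions.
    close-cycle : ∀ {k} ((p , _) : Path k) {w} → adj G (p zero) w ≡ true → w ≢ second p → ∀ j → p j ≢ w
    close-cycle (p , _) e _ zero eq = adj⇒≢ G e eq
    close-cycle {suc k} (p , _) _ w≢ (suc zero) eq = w≢ (sym eq)
    close-cycle {suc (suc k)} (p , inj , path) e _ j@(suc (suc j′)) refl = forest (toℕ j′ , p ∘ ι , ι-inj ∘ inj , steps , close)
      where
      le : 3 + toℕ j′ ≤ 3 + k
      le = Fin.toℕ<n j
      ι : Fin (3 + toℕ j′) → Fin (3 + k)
      ι i = Fin.inject≤ i le
      ι-inj : ∀ {i i′} → ι i ≡ ι i′ → i ≡ i′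
      ι-inj = Fin.inject≤-injective le le _ _
      steps : ∀ (i : Fin (2 + toℕ j′)) → adj G (p (ι (inject₁ i))) (p (ι (suc i))) ≡ true
      steps i = subst (λ l → adj G (p l) (p (ι (suc i))) ≡ true) (Fin.toℕ-injective eq) (path i′)
        where
        i′ = Fin.inject≤ i (ℕ.≤-pred le)
        eq : toℕ (inject₁ i′) ≡ toℕ (ι (inject₁ i))
        eq = trans (Fin.toℕ-inject₁ i′) (trans (Fin.toℕ-inject≤ i _)
          (sym (trans (Fin.toℕ-inject≤ (inject₁ i) le) (Fin.toℕ-inject₁ i))))
      close : adj G (p (ι (fromℕ (2 + toℕ j′)))) (p zero) ≡ true
      close = subst (λ l → adj G (p l) (p zero) ≡ true)
        (Fin.toℕ-injective (sym (trans (Fin.toℕ-inject≤ (fromℕ (2 + toℕ j′)) le) (Fin.toℕ-fromℕ (2 + toℕ j′)))))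
        (trans (adj-sym G (p j) (p zero)) e)

    long-path : V G → ∀ k → Path k
    long-path v zero = (λ _ → v) , (λ { {zero} {zero} _ → refl }) , λ ()
    long-path v (suc k) with P@(p , inj , path) ← long-path v k with w , e , w≢ ← branching (p zero) (second p) =
      q , q-inj , q-path
      where
      q : Fin (2 + k) → V G
      q zero = w
      q (suc i) = p i
      q-inj : ∀ {i j} → q i ≡ q j → i ≡ j
      q-inj {zero} {zero} _ = refl
      q-inj {zero} {suc j} eq = ⊥-elim (close-cycle P e w≢ j (sym eq))
      q-inj {suc i} {zero} eq = ⊥-elim (close-cycle P e w≢ i eq)
      q-inj {suc i} {suc j} eq = cong suc (inj eq)
      q-path : ∀ i → adj G (q (inject₁ i)) (q (suc i)) ≡ true
      q-path zero = trans (adj-sym G w (p zero)) e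
      q-path (suc i) = path i

  -- Every path could be prolonged at its start, but a path with `n G` edges has one vertex too
  -- many.
  branching-forest-empty : ¬ V G
  branching-forest-empty v = ℕ.1+n≰n (Fin.injective⇒≤ {f = proj₁ P} (proj₁ (proj₂ P)))
    where P = long-path v (n G)

-- Isolated vertices count as leaves.
Leaf : (G : Graph) → V G → Set
Leaf G v = ∀ u w → adj G v u ≡ true → adj G v w ≡ true → u ≡ w

leaf? : (G : Graph) (v : V G) → Dec (Leaf G v)
leaf? G v = Fin.all? λ u → Fin.all? λ w → (adj G v u 𝔹.≟ true) →-dec ((adj G v w 𝔹.≟ true) →-dec (u Fin.≟ w))

forest⇒leaf : (G : Graph) → Forest G → V G → ∃ (Leaf G)
forest⇒leaf G forest v₀ with Fin.any? (leaf? G)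
... | yes l = l
... | no ¬leaf = ⊥-elim (branching-forest-empty G branching forest v₀)
  where
  branching : ∀ v p → ∃ λ w → adj G v w ≡ true × w ≢ p
  branching v p with Fin.any? (λ w → (adj G v w 𝔹.≟ true) ×-dec ¬? (w Fin.≟ p))
  ... | yes found = found
  ... | no none = ⊥-elim (¬leaf (v , λ u w eu ew → trans (is-p eu) (sym (is-p ew))))
    where
    is-p : ∀ {w} → adj G v w ≡ true → w ≡ p
    is-p {w} e with w Fin.≟ p
    ... | yes eq = eq
    ... | no w≢p = ⊥-elim (none (w , e , w≢p))

puncture : ∀ {k m} → k ≡ suc m → (v : Fin k) → ∃ λ (σ : Fin m → Fin k) →
  (∀ i → σ i ≢ v) × (∀ {i j} → σ i ≡ σ j → i ≡ j) × (∀ x → x ≡ v ⊎ ∃ λ i → x ≡ σ i)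
puncture refl v = Fin.punchIn v , Fin.punchInᵢ≢i v , Fin.punchIn-injective v _ _ , split
  where
  split : ∀ x → x ≡ v ⊎ ∃ λ i → x ≡ Fin.punchIn v i
  split x with v Fin.≟ x
  ... | yes eq = inj₁ (sym eq)
  ... | no v≢x = inj₂ (Fin.punchOut v≢x , sym (Fin.punchIn-punchOut v≢x))

module _ (G : Graph) {m : ℕ} (eq : n G ≡ suc m) (v : V G) (leaf : Leaf G v) (σ : Fin m → V G)
  (σ≢v : ∀ i → σ i ≢ v) (σ-inj : ∀ {i j} → σ i ≡ σ j → i ≡ j) (split : ∀ x → x ≡ v ⊎ ∃ λ i → x ≡ σ i)
  (R : Rooting (pull G σ)) where

  private
    module R = Rooting R

    stem : Maybe (V G)
    stem with Fin.any? (λ w → adj G v w 𝔹.≟ true)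
    ... | yes (w , _) = just w
    ... | no _ = nothing

    stem⁻ : ∀ {p} → stem ≡ just p → adj G v p ≡ true
    stem⁻ h with Fin.any? (λ w → adj G v w 𝔹.≟ true)
    stem⁻ refl | yes (_ , e) = e

    stem⁺ : ∀ {p} → adj G v p ≡ true → stem ≡ just p
    stem⁺ {p} e with Fin.any? (λ w → adj G v w 𝔹.≟ true)
    ... | yes (w , e′) = cong just (leaf w p e′ e)
    ... | no none = ⊥-elim (none (p , e))

    par′ : ∀ {x} → x ≡ v ⊎ (∃ λ i → x ≡ σ i) → Maybe (V G)
    par′ (inj₁ _) = stem
    par′ (inj₂ (i , _)) = Maybe.map σ (R.parent i)

    rank′ : ∀ {x} → x ≡ v ⊎ (∃ λ i → x ≡ σ i) → ℕ
    rank′ (inj₁ _) = m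
    rank′ (inj₂ (i , _)) = R.rank i

    map-just : ∀ {mi : Maybe (Fin m)} {p} → Maybe.map σ mi ≡ just p → ∃ λ i → mi ≡ just i × p ≡ σ i
    map-just {just i} refl = i , refl , refl

    adj≢ = adj⇒≢ G

    rank<n′ : ∀ x → rank′ (split x) < n G
    rank<n′ x with split x
    ... | inj₁ _ = ℕ.≤-reflexive (sym eq)
    ... | inj₂ (i , _) = ℕ.≤-trans (ℕ.m<n⇒m<1+n (R.rank<n i)) (ℕ.≤-reflexive (sym eq))

    parent-adj′ : ∀ {x p} → par′ (split x) ≡ just p → adj G x p ≡ true
    parent-adj′ {x} h with split x
    ... | inj₁ refl = stem⁻ h
    ... | inj₂ (i , refl) with j , e , refl ← map-just {R.parent i} h = R.parent-adj e

    parent-rank′ : ∀ {x p} → par′ (split x) ≡ just p → rank′ (split p) < rank′ (split x)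
    parent-rank′ {x} {p} h with split x | split p
    ... | inj₁ refl | inj₁ refl = ⊥-elim (adj≢ (stem⁻ h) refl)
    ... | inj₁ _ | inj₂ (j , _) = R.rank<n j
    ... | inj₂ (i , _) | inj₁ refl with j , _ , e ← map-just {R.parent i} h = ⊥-elim (σ≢v j (sym e))
    ... | inj₂ (i , _) | inj₂ (j , refl) with j′ , e , σj≡ ← map-just {R.parent i} h =
      R.parent-rank (trans e (cong just (σ-inj (sym σj≡))))

    edge′ : ∀ {u w} → adj G u w ≡ true → par′ (split u) ≡ just w ⊎ par′ (split w) ≡ just u
    edge′ {u} {w} e with split u | split w
    ... | inj₁ refl | _ = inj₁ (stem⁺ e)
    ... | inj₂ _ | inj₁ refl = inj₂ (stem⁺ (trans (adj-sym G w u) e))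
    ... | inj₂ (i , refl) | inj₂ (j , refl) with R.edge e
    ...   | inj₁ h = inj₁ (cong (Maybe.map σ) h)
    ...   | inj₂ h = inj₂ (cong (Maybe.map σ) h)

  -- The leaf becomes a child of its only neighbour, if it has one, and a parent of nothing. Its
  -- rank `m` exceeds all ranks of the rest.
  attach-leaf : Rooting G
  attach-leaf = record
    { parent = par′ ∘ split ; rank = rank′ ∘ split ; rank<n = rank<n′
    ; parent-adj = parent-adj′ ; parent-rank = λ {x} {p} → parent-rank′ {x} {p} ; edge = edge′ }

forest⇒rooting : (G : Graph) → Forest G → Rooting G
forest⇒rooting G = go (n G) G refl
  where
  go : ∀ m G → n G ≡ m → Forest G → Rooting G
  go zero G eq _ = record
    { parent = λ _ → nothing ; rank = λ _ → 0 ; rank<n = λ v → ⊥-elim (Fin.¬Fin0 (subst Fin eq v))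
    ; parent-adj = λ () ; parent-rank = λ () ; edge = λ {u} → ⊥-elim (Fin.¬Fin0 (subst Fin eq u)) }
  go (suc m) G eq forest
    with v , leaf ← forest⇒leaf G forest (subst Fin (sym eq) zero)
    with σ , σ≢v , σ-inj , split ← puncture eq v
    = attach-leaf G eq v leaf σ σ≢v σ-inj split (go m (pull G σ) refl (pull-forest {G} σ-inj forest))

-- Stable sets and clique covers

Stable : (G : Graph) → List (V G) → Set
Stable G S = ∀ {x y} → x ∈ S → y ∈ S → adj G x y ≢ true

module _ {G : Graph} (R : Rooting G) where
  open Rooting R

  -- The parent serves as `p`, since all other neighbours are children and have larger rank. A
  -- vertex without a parent is its own partner, which later gives a clique with a single vertex.
  partner : ∀ v → ∃ λ p → (v ≡ p ⊎ adj G v p ≡ true) × (∀ {w} → adj G v w ≡ true → rank w ≤ rank v → w ≡ p)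
  partner v with parent v in eq
  ... | nothing = v , inj₁ refl , λ {w} e le → go e le (edge e)
    where
    go : ∀ {w} → adj G v w ≡ true → rank w ≤ rank v → parent v ≡ just w ⊎ parent w ≡ just v → w ≡ v
    go _ _ (inj₁ h) with () ← trans (sym eq) h
    go _ le (inj₂ h) = ⊥-elim (ℕ.<⇒≱ (parent-rank h) le)
  ... | just p = p , inj₂ (parent-adj eq) , λ e le → go le (edge e)
    where
    go : ∀ {w} → rank w ≤ rank v → parent v ≡ just w ⊎ parent w ≡ just v → w ≡ p
    go _ (inj₁ h) = Maybe.just-injective (trans (sym h) eq)
    go le (inj₂ h) = ⊥-elim (ℕ.<⇒≱ (parent-rank h) le)

  -- A stable set meets a clique at most once, so `S` and `Q` certify each other as optimal. Through
  -- `same-size`, the bound of `S` by `α` becomes a bound on the number of pairs in `Q`.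
  record StableCover (F : List (V G)) : Set where
    field
      S : List (V G)
      Q : List (V G × V G)
      S-unique : Unique S
      S⊆F : ∀ {x} → x ∈ S → x ∈ F
      S-stable : Stable G S
      Q-cliques : ∀ {v p} → (v , p) ∈ Q → v ≡ p ⊎ adj G v p ≡ true
      covers : ∀ {x} → x ∈ F → ∃ λ v → ∃ λ p → (v , p) ∈ Q × (x ≡ v ⊎ x ≡ p)
      same-size : length Q ≡ length S

  -- The deepest vertex of F has at most its parent as a neighbour in F, so it can be put into S, and the clique it
  -- forms with its parent into Q.
  stable-cover : ∀ k (F : List (V G)) → length F ≤ k → StableCover F
  stable-cover k [] _ = record
    { S = [] ; Q = [] ; S-unique = [] ; S⊆F = λ () ; S-stable = λ () ; Q-cliques = λ () ; covers = λ () ; same-size = refl }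
  stable-cover (suc k) F@(x ∷ xs) le with p , clique , only ← partner (argmax rank x xs) = record
    { S = v ∷ S ; Q = (v , p) ∷ Q
    ; S-unique = All.tabulate (λ { w∈ refl → proj₁ (kept w∈) refl }) ∷ S-unique
    ; S⊆F = λ { (here refl) → v∈F ; (there w∈) → proj₁ (∈.∈-filter⁻ keep? {xs = F} (S⊆F w∈)) }
    ; S-stable = stable
    ; Q-cliques = λ { (here refl) → clique ; (there q∈) → Q-cliques q∈ }
    ; covers = cov
    ; same-size = cong suc same-size
    }
    where
    v = argmax rank x xs
    v∈F : v ∈ F
    v∈F with argmax-sel rank x xs
    ... | inj₁ eq = here eq
    ... | inj₂ v∈xs = there v∈xs
    deepest : ∀ {w} → w ∈ F → rank w ≤ rank v
    deepest = All.lookup (f[⊥]≤f[argmax] {f = rank} x xs ∷ f[xs]≤f[argmax] {f = rank} x xs)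
    keep? = λ w → ¬? (w Fin.≟ v) ×-dec ¬? (w Fin.≟ p)
    F′ = List.filter keep? F
    shorter : length F′ ≤ k
    shorter = ℕ.≤-pred (ℕ.≤-trans (List.filter-notAll keep? F (Any.map (λ { refl (v≢v , _) → v≢v refl }) v∈F)) le)
    open StableCover (stable-cover k F′ shorter)
    kept : ∀ {w} → w ∈ S → w ≢ v × w ≢ p
    kept w∈ = proj₂ (∈.∈-filter⁻ keep? {xs = F} (S⊆F w∈))
    v≁S : ∀ {w} → w ∈ S → adj G v w ≢ true
    v≁S w∈ e = proj₂ (kept w∈) (only e (deepest (proj₁ (∈.∈-filter⁻ keep? {xs = F} (S⊆F w∈)))))
    stable : Stable G (v ∷ S)
    stable (here refl) (here refl) e = adj⇒≢ G e refl
    stable (here refl) (there y∈) e = v≁S y∈ e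
    stable {x} (there x∈) (here refl) e = v≁S x∈ (trans (adj-sym G v x) e)
    stable (there x∈) (there y∈) e = S-stable x∈ y∈ e
    cov : ∀ {w} → w ∈ F → ∃ λ u → ∃ λ q → (u , q) ∈ (v , p) ∷ Q × (w ≡ u ⊎ w ≡ q)
    cov {w} w∈ with w Fin.≟ v | w Fin.≟ p
    ... | yes eq | _ = v , p , here refl , inj₁ eq
    ... | no _ | yes eq = v , p , here refl , inj₂ eq
    ... | no w≢v | no w≢p with u , q , uq∈ , h ← covers (∈.∈-filter⁺ keep? w∈ (w≢v , w≢p)) = u , q , there uq∈ , h

private
  ≤-foldr-⊔ : {A : Set} (f : A → ℕ) {xs : List A} {x : A} → x ∈ xs → f x ≤ List.foldr _⊔_ 0 (map f xs)
  ≤-foldr-⊔ f (here refl) = ℕ.m≤m⊔n _ _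
  ≤-foldr-⊔ f (there x∈) = ℕ.≤-trans (≤-foldr-⊔ f x∈) (ℕ.m≤n⊔m _ _)

  foldr-⊔-attained : {A : Set} (f : A → ℕ) (xs : List A) →
    List.foldr _⊔_ 0 (map f xs) ≡ 0 ⊎ ∃ λ x → x ∈ xs × f x ≡ List.foldr _⊔_ 0 (map f xs)
  foldr-⊔-attained f [] = inj₁ refl
  foldr-⊔-attained f (x ∷ xs) with ℕ.⊔-sel (f x) (List.foldr _⊔_ 0 (map f xs)) | foldr-⊔-attained f xs
  ... | inj₁ eq | _ = inj₂ (x , here refl , sym eq)
  ... | inj₂ eq | inj₁ z = inj₁ (trans eq z)
  ... | inj₂ eq | inj₂ (y , y∈ , fy) = inj₂ (y , there y∈ , trans fy (sym eq))

<ᵇ⁺ : ∀ {a b} → a < b → (a <ᵇ b) ≡ true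
<ᵇ⁺ lt = Equivalence.to 𝔹.T-≡ (ℕ.<⇒<ᵇ lt)

<ᵇ⁻ : ∀ {a b} → (a <ᵇ b) ≡ true → a < b
<ᵇ⁻ {a} {b} eq = ℕ.<ᵇ⇒< a b (Equivalence.from 𝔹.T-≡ eq)

∈-allBools : (b : Bool) → b ∈ allBools
∈-allBools true = here refl
∈-allBools false = there (here refl)

stable≤α : (s : ℕ) (G : Graph) {L : List (V G)} → Unique L → (∀ {x} → x ∈ L → degree G x ≤ s) → Stable G L →
  length L ≤ α s G
stable≤α s G {L} u low stable = ℕ.≤-trans (length≤∣S∣ S u (λ {x} x∈ → trans (Vec.lookup∘tabulate _ x) (dec-true (x ∈? L) x∈)))
  (≤-foldr-⊔ ∣_∣ (∈-filterᵇ⁺ _ (∈-allVecs S (λ i → ∈-allBools _)) good))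
  where
  open DecMembership Fin._≟_ using (_∈?_)
  S = Vec.tabulate λ x → does (x ∈? L)
  S⁻ : ∀ {x} → lookup S x ≡ true → x ∈ L
  S⁻ {x} h = dec⁻ (x ∈? L) (trans (sym (Vec.lookup∘tabulate _ x)) h)
  good : (∀ᵇ λ x → lookup S x ⇒ᵇ ((degree G x <ᵇ suc s) ∧ (∀ᵇ λ y → lookup S y ⇒ᵇ not (adj G x y)))) ≡ true
  good = ∀ᵇ⁺ λ x → ⇒ᵇ⁺ {lookup S x} λ x∈ → ∧⁺ (<ᵇ⁺ (s≤s (low (S⁻ x∈))))
    (∀ᵇ⁺ λ y → ⇒ᵇ⁺ {lookup S y} λ y∈ → not⁺ (stable (S⁻ x∈) (S⁻ y∈)))

α-attained : (s : ℕ) (G : Graph) → ∃ λ (S : Subset (n G)) → ∣ S ∣ ≡ α s G ×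
  (∀ {x} → lookup S x ≡ true → degree G x ≤ s) ×
  (∀ {x y} → lookup S x ≡ true → lookup S y ≡ true → adj G x y ≢ true)
α-attained s G with foldr-⊔-attained ∣_∣ (filterᵇ
    (λ S → ∀ᵇ λ x → lookup S x ⇒ᵇ ((degree G x <ᵇ suc s) ∧ (∀ᵇ λ y → lookup S y ⇒ᵇ not (adj G x y))))
    (allVecs allBools (n G)))
-- The value 0 may be the default of the fold and not the size of a listed set; the empty set
-- attains it in any case.
... | inj₁ z = Subset.⊥ , trans (Subset.∣⊥∣≡0 (n G)) (sym z) ,
  (λ {x} h → ⊥-elim (∉∅ x h)) , (λ {x} h _ → ⊥-elim (∉∅ x h))
  where
  ∉∅ : ∀ x → lookup (Subset.⊥ {n G}) x ≢ true
  ∉∅ x h with () ← trans (sym h) (Vec.lookup-replicate x false)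
... | inj₂ (S , S∈ , eq) with _ , good ← ∈-filterᵇ⁻ _ {allVecs allBools (n G)} S∈ = S , eq ,
  (λ {x} h → ℕ.≤-pred (<ᵇ⁻ (proj₁ (low x h)))) ,
  (λ {x} {y} hx hy → not⁻ (⇒ᵇ⁻ {lookup S y} (∀ᵇ⁻ (proj₂ (low x hx)) y) hy))
  where
  low : ∀ x → lookup S x ≡ true →
    (degree G x <ᵇ suc s) ≡ true × (∀ᵇ λ y → lookup S y ⇒ᵇ not (adj G x y)) ≡ true
  low x h = ∧⁻ {degree G x <ᵇ suc s} (⇒ᵇ⁻ {lookup S x} (∀ᵇ⁻ good x) h)

-- A leaf has degree at most 1, hence at most `s`. The lower bound needs a vertex that may have any
-- number of copies, to absorb the leftover vertices.
forest⇒α≥1 : (s : ℕ) → 1 ≤ s → (G : Graph) → Forest G → V G → 1 ≤ α s G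
forest⇒α≥1 s 1≤s G forest v₀ with v , leaf ← forest⇒leaf G forest v₀ =
  stable≤α s G {v ∷ []} ([] ∷ []) (λ { (here refl) → ℕ.≤-trans degree≤1 1≤s })
    (λ { (here refl) (here refl) e → adj⇒≢ G e refl })
  where
  degree≤1 : degree G v ≤ 1
  degree≤1 with neighbours G v in eq
  ... | [] = z≤n
  ... | w ∷ ws = unique-⊆⇒length-≤ (subst Unique eq (neighbours-unique G v)) (w ∷ []) λ {x} x∈ →
    here (leaf x w (adj-of x∈) (adj-of (here refl)))
    where
    adj-of : ∀ {x} → x ∈ w ∷ ws → adj G v x ≡ true
    adj-of x∈ = neighbours⁻ G (subst (_ ∈_) (sym eq) x∈)

-- K_{s+1,t} minors from disjoint extensions

K-side-left : ∀ a {b} (u : Fin (a + b)) {i} → Fin.splitAt a u ≡ inj₁ i → (toℕ u <ᵇ a) ≡ true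
K-side-left a {b} u {i} eq rewrite sym (Fin.splitAt⁻¹-↑ˡ {a} {b} {u} eq) | Fin.toℕ-↑ˡ i b = <ᵇ⁺ (Fin.toℕ<n i)

K-side-right : ∀ a {b} (u : Fin (a + b)) {j} → Fin.splitAt a u ≡ inj₂ j → (toℕ u <ᵇ a) ≡ false
K-side-right a {b} u {j} eq rewrite sym (Fin.splitAt⁻¹-↑ʳ {a} {b} {u} eq) | Fin.toℕ-↑ʳ a j =
  𝔹.¬-not λ h → ℕ.<⇒≱ (<ᵇ⁻ {a + toℕ j} {a} h) (ℕ.m≤m+n a (toℕ j))

K-edge : ∀ a b (u v : Fin (a + b)) → adj (K a b) u v ≡ true →
  (∃ λ i → ∃ λ j → Fin.splitAt a u ≡ inj₁ i × Fin.splitAt a v ≡ inj₂ j) ⊎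
  (∃ λ i → ∃ λ j → Fin.splitAt a u ≡ inj₂ j × Fin.splitAt a v ≡ inj₁ i)
K-edge a b u v e with Fin.splitAt a u in eu | Fin.splitAt a v in ev
... | inj₁ i | inj₂ j = inj₁ (i , j , refl , refl)
... | inj₂ j | inj₁ i = inj₂ (i , j , refl , refl)
... | inj₁ _ | inj₁ _ rewrite K-side-left a {b} u eu | K-side-left a {b} v ev with () ← e
... | inj₂ _ | inj₂ _ rewrite K-side-right a {b} u eu | K-side-right a {b} v ev with () ← e

-- Contracting `X` leaves a star whose `a` leaves lie outside `U`. Several such stars with common
-- leaves and disjoint centres form a complete bipartite graph.
record Hub (G : Graph) (U : List (V G)) (a : ℕ) : Set where
  field
    X : List (V G)
    X⊆U : ∀ {x} → x ∈ X → x ∈ U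
    root : V G
    root∈X : root ∈ X
    X-connected : ∀ {x} → x ∈ X → WalkIn G (_∈ X) root x
    w : Fin a → V G
    w-injective : ∀ {i j} → w i ≡ w j → i ≡ j
    w∉U : ∀ i → w i ∉ U
    w-attached : ∀ i → ∃ λ x → x ∈ X × adj G x (w i) ≡ true

-- Let `u` be a vertex of `U` of least rank. From each of `s + 1` neighbours of `u`, go down through
-- children until `U` is left. The vertices passed form `X` together with `u`, and the ends of the
-- descents are distinct because they lie in different branches at `u`.
module FindHub {G : Graph} (R : Rooting G) {s : ℕ} (1≤s : 1 ≤ s) (U : List (V G))
  (high : ∀ {v} → v ∈ U → suc s ≤ degree G v) where
  open Rooting R
  open DecMembership (Fin._≟_ {n G}) using (_∈?_)

  private
    data Down : V G → V G → Set where
      stop : ∀ {v} → v ∉ U → Down v v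
      go : ∀ {v c w} → v ∈ U → parent c ≡ just v → Down c w → Down v w

    path : ∀ {v w} → Down v w → List (V G)
    path (stop _) = []
    path (go {v} _ _ d) = v ∷ path d

    path⊆U : ∀ {v w} (d : Down v w) {x} → x ∈ path d → x ∈ U
    path⊆U (go v∈U _ d) (here refl) = v∈U
    path⊆U (go _ _ d) (there x∈) = path⊆U d x∈

    end∉U : ∀ {v w} → Down v w → w ∉ U
    end∉U (stop v∉U) = v∉U
    end∉U (go _ _ d) = end∉U d

    child-adj : ∀ {v c} → parent c ≡ just v → adj G v c ≡ true
    child-adj {v} {c} h = trans (adj-sym G v c) (parent-adj h)

    path-walk : ∀ {P : V G → Set} {u v w} (d : Down v w) → adj G u v ≡ true → P u → (∀ {x} → x ∈ path d → P x) →
      ∀ {x} → x ∈ path d → WalkIn G P u x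
    path-walk (go _ _ d) e p h (here refl) = step p e (here (h (here refl)))
    path-walk (go _ h′ d) e p h (there x∈) =
      step p e (path-walk d (child-adj h′) (h (here refl)) (h ∘ there) x∈)

    path-attached : ∀ {u v w} (d : Down v w) → adj G u v ≡ true → ∃ λ x → x ∈ u ∷ path d × adj G x w ≡ true
    path-attached {u} (stop _) e = u , here refl , e
    path-attached (go _ h d) e with x , x∈ , e′ ← path-attached d (child-adj h) = x , there x∈ , e′

    -- A childless vertex has at most its parent as a neighbour, whereas `1≤s` makes degrees in `U`
    -- at least 2. So a descent never gets stuck inside `U`.
    child : ∀ {v} → v ∈ U → ∃ λ c → parent c ≡ just v
    child {v} v∈U with Fin.any? (λ c → Maybe.≡-dec Fin._≟_ (parent c) (just v))
    ... | yes c = c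
    ... | no childless = ⊥-elim (ℕ.<⇒≱ (ℕ.≤-trans (s≤s 1≤s) (high v∈U)) degree≤1)
      where
      to-parent : ∀ {w} → w ∈ neighbours G v → parent v ≡ just w
      to-parent {w} w∈ with edge (neighbours⁻ G w∈)
      ... | inj₁ h = h
      ... | inj₂ h = ⊥-elim (childless (w , h))
      degree≤1 : degree G v ≤ 1
      degree≤1 with parent v in eq
      ... | just p = unique-⊆⇒length-≤ (neighbours-unique G v) (p ∷ []) λ w∈ →
        here (sym (Maybe.just-injective (trans (sym eq) (to-parent w∈))))
      ... | nothing = ℕ.≤-trans (unique-⊆⇒length-≤ (neighbours-unique G v) [] λ w∈ → absurd (trans (sym eq) (to-parent w∈))) z≤n
        where
        absurd : ∀ {w x : V G} → nothing ≡ just w → x ∈ []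
        absurd ()

    -- `f` is fuel: ranks grow on the way down and stay below `n G`.
    down : ∀ f v → n G ≤ f + rank v → ∃ (Down v)
    down zero v le = ⊥-elim (ℕ.<⇒≱ (rank<n v) le)
    down (suc f) v le with v ∈? U
    ... | no v∉U = v , stop v∉U
    ... | yes v∈U with c , h ← child v∈U
      with w , d ← down f c (ℕ.≤-trans le (ℕ.≤-trans (ℕ.≤-reflexive (sym (ℕ.+-suc f (rank v)))) (ℕ.+-monoʳ-≤ f (parent-rank h))))
      = w , go v∈U h d

    data Ancestor (a : V G) : V G → Set where
      self : Ancestor a a
      up : ∀ {b p} → parent b ≡ just p → Ancestor a p → Ancestor a b

    ancestor-rank : ∀ {a b} → Ancestor a b → rank a ≤ rank b
    ancestor-rank self = ℕ.≤-refl
    ancestor-rank (up h anc) = ℕ.≤-trans (ancestor-rank anc) (ℕ.<⇒≤ (parent-rank h))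

    ancestor-parent : ∀ {a b c} → parent b ≡ just a → Ancestor b c → Ancestor a c
    ancestor-parent h self = up h self
    ancestor-parent h (up h′ anc) = up h′ (ancestor-parent h anc)

    ancestors-chain : ∀ {a b c} → Ancestor a c → Ancestor b c → Ancestor a b ⊎ Ancestor b a
    ancestors-chain self anc = inj₂ anc
    ancestors-chain anc self = inj₁ anc
    ancestors-chain (up h anc) (up h′ anc′) with refl ← Maybe.just-injective (trans (sym h) h′) = ancestors-chain anc anc′

    down⇒ancestor : ∀ {v w} → Down v w → Ancestor v w
    down⇒ancestor (stop _) = self
    down⇒ancestor (go _ h d) = ancestor-parent h (down⇒ancestor d)

    ancestor-siblings : ∀ {u y z} → parent y ≡ just u → parent z ≡ just u → Ancestor y z → y ≡ z
    ancestor-siblings hy hz self = refl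
    ancestor-siblings hy hz (up h anc) with refl ← Maybe.just-injective (trans (sym h) hz) =
      ⊥-elim (ℕ.<⇒≱ (parent-rank hy) (ancestor-rank anc))

    module _ {u : V G} (top : ∀ {v} → v ∈ U → rank u ≤ rank v) where

      parent∉U : ∀ {y} → parent u ≡ just y → y ∉ U
      parent∉U h y∈ = ℕ.<⇒≱ (parent-rank h) (top y∈)

      -- The hypotheses are contradictory. The parent `y` of `u` is outside `U` as `u` has least
      -- rank, so the descent from `y` stops at once; but `y` has too small a rank to lie below the
      -- child `z`.
      parent≢child : ∀ {y z w} → parent u ≡ just y → parent z ≡ just u → Down y w → Down z w → y ≡ z
      parent≢child hy hz (go y∈ _ _) _ = ⊥-elim (parent∉U hy y∈)
      parent≢child hy hz (stop _) d = ⊥-elim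
        (ℕ.<⇒≱ (ℕ.<-trans (parent-rank hy) (parent-rank hz)) (ancestor-rank (down⇒ancestor d)))

      -- Two ancestors of `w` are comparable, and comparable children of `u` coincide.
      branches-disjoint : ∀ {y z w} → adj G u y ≡ true → adj G u z ≡ true → Down y w → Down z w → y ≡ z
      branches-disjoint ey ez dy dz with edge ey | edge ez
      ... | inj₁ hy | inj₁ hz = Maybe.just-injective (trans (sym hy) hz)
      ... | inj₁ hy | inj₂ hz = parent≢child hy hz dy dz
      ... | inj₂ hy | inj₁ hz = sym (parent≢child hz hy dz dy)
      ... | inj₂ hy | inj₂ hz with ancestors-chain (down⇒ancestor dy) (down⇒ancestor dz)
      ...   | inj₁ anc = ancestor-siblings hy hz anc
      ...   | inj₂ anc = sym (ancestor-siblings hz hy anc)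

      hub-at : u ∈ U → Hub G U (suc s)
      hub-at u∈U = record
        { X = X ; X⊆U = X⊆U ; root = u ; root∈X = here refl ; X-connected = connected
        ; w = w ; w-injective = λ {i} {j} eq → Fin.inject≤-injective (high u∈U) (high u∈U) i j
            (unique-lookup (neighbours-unique G u)
              (branches-disjoint (u~y i) (u~y j) (d i) (subst (Down (y j)) (sym eq) (d j))))
        ; w∉U = λ i → end∉U (d i)
        ; w-attached = λ i → let x , x∈ , e = path-attached (d i) (u~y i) in x , attach i x∈ , e
        }
        where
        y : Fin (suc s) → V G
        y i = List.lookup (neighbours G u) (Fin.inject≤ i (high u∈U))
        u~y : ∀ i → adj G u (y i) ≡ true
        u~y i = neighbours⁻ G (∈.∈-lookup (Fin.inject≤ i (high u∈U)))
        below : ∀ i → ∃ (Down (y i))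
        below i = down (n G) (y i) (ℕ.m≤m+n (n G) _)
        w : Fin (suc s) → V G
        w i = proj₁ (below i)
        d : ∀ i → Down (y i) (w i)
        d i = proj₂ (below i)
        paths = concatMap (λ i → path (d i)) (allFin (suc s))
        X = u ∷ paths
        in-X : ∀ i {x} → x ∈ path (d i) → x ∈ X
        in-X i x∈ = there (∈-concatMap⁺ _ (∈.∈-allFin i) x∈)
        attach : ∀ i {x} → x ∈ u ∷ path (d i) → x ∈ X
        attach i (here refl) = here refl
        attach i (there x∈) = in-X i x∈
        X⊆U : ∀ {x} → x ∈ X → x ∈ U
        X⊆U (here refl) = u∈U
        X⊆U (there x∈) with i , _ , x∈d ← ∈-concatMap⁻ _ (allFin (suc s)) x∈ = path⊆U (d i) x∈d
        connected : ∀ {x} → x ∈ X → WalkIn G (_∈ X) u x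
        connected (here refl) = here (here refl)
        connected (there x∈) with i , _ , x∈d ← ∈-concatMap⁻ _ (allFin (suc s)) x∈ =
          path-walk (d i) (u~y i) (here refl) (in-X i) x∈d

  hub : ∀ {v} → v ∈ U → Hub G U (suc s)
  hub {v} v∈U = hub-at {u} (All.lookup (f[argmin]≤f[xs] {f = rank} v U)) u∈U
    where
    u = argmin rank v U
    u∈U : u ∈ U
    u∈U with argmin-sel rank v U
    ... | inj₁ eq = subst (_∈ U) (sym eq) v∈U
    ... | inj₂ u∈ = u∈

record IsEmbedding (H G : Graph) (f : V H → V G) : Set where
  field
    injective : ∀ {u v} → f u ≡ f v → u ≡ v
    edges : ∀ {u v} → adj H u v ≡ true → adj G (f u) (f v) ≡ true

-- The common images of the wᵢ and the disjoint images of X are the two sides of the minor.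
hub⇒minor : {T G : Graph} {U : List (V T)} {a t : ℕ} → Hub T U a → 1 ≤ t →
  (f : Fin t → V T → V G) → (∀ i → IsEmbedding T G (f i)) →
  (∀ i j {v} → v ∉ U → f i v ≡ f j v) →
  (∀ {i j} → i ≢ j → ∀ {u v} → u ∈ U → v ∈ U → f i u ≢ f j v) →
  Minor (K a t) G
hub⇒minor {T} {G} {U} {a} {suc t′} H _ f emb agree disj = branch-sets⇒minor B B? disjoint rooted edge
  where
  open Hub H
  open DecMembership (Fin._≟_ {n G}) using (_∈?_)
  t = suc t′
  module E i = IsEmbedding (emb i)
  Branch : Fin a ⊎ Fin t → V G → Set
  Branch (inj₁ i) z = f zero (w i) ≡ z
  Branch (inj₂ j) z = z ∈ map (f j) X
  Branch? : ∀ v z → Dec (Branch v z)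
  Branch? (inj₁ i) z = f zero (w i) Fin.≟ z
  Branch? (inj₂ j) z = z ∈? map (f j) X
  B : V (K a t) → V G → Set
  B v = Branch (Fin.splitAt a v)
  B? : ∀ v z → Dec (B v z)
  B? v = Branch? (Fin.splitAt a v)
  f₀w : ∀ i j → f zero (w i) ≡ f j (w i)
  f₀w i j = agree zero j (w∉U i)
  w∉image : ∀ i j → f zero (w i) ∉ map (f j) X
  w∉image i j h with x , x∈ , eq ← ∈.∈-map⁻ (f j) h =
    w∉U i (subst (_∈ U) (E.injective j (trans (sym eq) (f₀w i j))) (X⊆U x∈))
  branches-disjoint : ∀ u v {z} → Branch u z → Branch v z → u ≡ v
  branches-disjoint (inj₁ i) (inj₁ j) refl q = cong inj₁ (w-injective (E.injective zero (sym q)))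
  branches-disjoint (inj₁ i) (inj₂ j) refl q = ⊥-elim (w∉image i j q)
  branches-disjoint (inj₂ j) (inj₁ i) q refl = ⊥-elim (w∉image i j q)
  branches-disjoint (inj₂ i) (inj₂ j) p q with i Fin.≟ j
  ... | yes refl = refl
  ... | no i≢j with x , x∈ , refl ← ∈.∈-map⁻ (f i) p with y , y∈ , eq ← ∈.∈-map⁻ (f j) q =
    ⊥-elim (disj i≢j (X⊆U x∈) (X⊆U y∈) eq)
  disjoint : ∀ {u v z} → B u z → B v z → u ≡ v
  disjoint {u} {v} p q = trans (sym (Fin.join-splitAt a t u))
    (trans (cong (Fin.join a t) (branches-disjoint (Fin.splitAt a u) (Fin.splitAt a v) p q)) (Fin.join-splitAt a t v))
  branch-rooted : ∀ v → ∃ λ r → Branch v r × (∀ {z} → Branch v z → WalkIn G (Branch v) r z)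
  branch-rooted (inj₁ i) = f zero (w i) , refl , λ { refl → here refl }
  branch-rooted (inj₂ j) = f j root , ∈.∈-map⁺ (f j) root∈X , walk
    where
    walk : ∀ {z} → z ∈ map (f j) X → WalkIn G (_∈ map (f j) X) (f j root) z
    walk z∈ with x , x∈ , refl ← ∈.∈-map⁻ (f j) z∈ = walk-hom (f j) (E.edges j) (∈.∈-map⁺ (f j)) (X-connected x∈)
  rooted : ∀ v → ∃ λ r → B v r × (∀ {z} → B v z → WalkIn G (B v) r z)
  rooted v = branch-rooted (Fin.splitAt a v)
  attached : ∀ i j → ∃ λ y → Branch (inj₂ j) y × adj G y (f zero (w i)) ≡ true
  attached i j with x , x∈ , e ← w-attached i =
    f j x , ∈.∈-map⁺ (f j) x∈ , subst (λ z → adj G (f j x) z ≡ true) (sym (f₀w i j)) (E.edges j e)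
  edge : ∀ u v → adj (K a t) u v ≡ true → ∃ λ x → ∃ λ y → B u x × B v y × adj G x y ≡ true
  edge u v e with K-edge a t u v e
  ... | inj₁ (i , j , eu , ev) rewrite eu | ev with y , y∈ , e′ ← attached i j =
    f zero (w i) , y , refl , y∈ , trans (adj-sym G (f zero (w i)) y) e′
  ... | inj₂ (i , j , eu , ev) rewrite eu | ev with y , y∈ , e′ ← attached i j =
    y , f zero (w i) , y∈ , refl , e′

-- Counting embeddings

-- Greedily pick members of L with disjoint images; if this stops early, the images picked so far meet all others.
disjoint-or-hit : {A B : Set} (_≟_ : (x y : B) → Dec (x ≡ y)) (im : A → List B) {ℓ : ℕ} → (∀ a → length (im a) ≤ ℓ) →
  (L : List A) → ∀ t →
  (∃ λ (f : Fin t → A) → (∀ i → f i ∈ L) × (∀ {i j} → i ≢ j → ∀ {b} → b ∈ im (f i) → b ∉ im (f j))) ⊎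
  (∃ λ H → length H ≤ t * ℓ × (∀ {a} → a ∈ L → ∃ λ b → b ∈ H × b ∈ im a))
disjoint-or-hit _≟_ im small L zero = inj₁ ((λ ()) , (λ ()) , λ { {()} })
disjoint-or-hit {A} _≟_ im {ℓ} small L (suc t) with disjoint-or-hit _≟_ im small L t
... | inj₂ (H , len , hit) = inj₂ (H , ℕ.≤-trans len (ℕ.m≤n+m (t * ℓ) ℓ) , hit)
... | inj₁ (f , f∈ , disj) with Any.any? (λ a → ¬? (Any.any? (_∈? hit) (im a))) L
  where
  open DecMembership _≟_ using (_∈?_)
  hit = concatMap (im ∘ f) (allFin t)
...   | yes found with a , a∈ , miss ← ∈.find found = inj₁ (f′ , f′∈ , disj′)
  where
  hit = concatMap (im ∘ f) (allFin t)
  f′ : Fin (suc t) → A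
  f′ zero = a
  f′ (suc i) = f i
  f′∈ : ∀ i → f′ i ∈ L
  f′∈ zero = a∈
  f′∈ (suc i) = f∈ i
  avoids : ∀ i {b} → b ∈ im a → b ∉ im (f i)
  avoids i b∈a b∈fi = miss (∈.lose b∈a (∈-concatMap⁺ (im ∘ f) (∈.∈-allFin i) b∈fi))
  disj′ : ∀ {i j} → i ≢ j → ∀ {b} → b ∈ im (f′ i) → b ∉ im (f′ j)
  disj′ {zero} {zero} ne = ⊥-elim (ne refl)
  disj′ {zero} {suc j} _ p q = avoids j p q
  disj′ {suc i} {zero} _ p q = avoids i q p
  disj′ {suc i} {suc j} ne = disj (ne ∘ cong suc)
...   | no none = inj₂ (hit , len , hits)
  where
  open DecMembership _≟_ using (_∈?_)
  hit = concatMap (im ∘ f) (allFin t)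
  len : length hit ≤ ℓ + t * ℓ
  len = ℕ.≤-trans (length-concatMap-≤ (im ∘ f) (small ∘ f) (allFin t))
    (ℕ.≤-trans (ℕ.≤-reflexive (cong (_* ℓ) (List.length-tabulate {n = t} id))) (ℕ.m≤n+m (t * ℓ) ℓ))
  hits : ∀ {a} → a ∈ L → ∃ λ b → b ∈ hit × b ∈ im a
  hits {a} a∈ with Any.any? (_∈? hit) (im a)
  ... | yes found with b , b∈ , b∈hit ← ∈.find found = b , b∈hit , b∈
  ... | no miss = ⊥-elim (none (∈.lose a∈ miss))

Clique : (G : Graph) → V G × V G → Set
Clique G (a , b) = a ≡ b ⊎ adj G a b ≡ true

IsEmb : (T G : Graph) → Vec (V G) (n T) → Set
IsEmb T G e = IsEmbedding T G (lookup e)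

isEmb? : (T G : Graph) → ∀ e → Dec (IsEmb T G e)
isEmb? T G e = map′ (λ (i , h) → record { injective = i _ _ ; edges = h _ _ })
  (λ emb → (λ _ _ → IsEmbedding.injective emb) , (λ _ _ → IsEmbedding.edges emb))
  ((Fin.all? λ u → Fin.all? λ v → (lookup e u Fin.≟ lookup e v) →-dec (u Fin.≟ v)) ×-dec
   (Fin.all? λ u → Fin.all? λ v → (adj T u v 𝔹.≟ true) →-dec (adj G (lookup e u) (lookup e v) 𝔹.≟ true)))

-- `g` acts as a partial assignment: positions in `R` are still free, and the entries of `g` there
-- are placeholders.
AgreeOff : {A : Set} {k : ℕ} → List (Fin k) → Vec A k → Vec A k → Set
AgreeOff R e g = ∀ v → v ∈ R ⊎ lookup e v ≡ lookup g v

agree-update : {A : Set} {k : ℕ} {R R′ : List (Fin k)} (e g : Vec A k) (v : Fin k) →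
  (∀ {w} → w ∈ R → w ≡ v ⊎ w ∈ R′) → AgreeOff R e g → AgreeOff R′ e (g Vec.[ v ]≔ lookup e v)
agree-update e g v shrink agree w with w Fin.≟ v
... | yes refl = inj₂ (sym (Vec.lookup∘update v g _))
... | no w≢v with agree w
...   | inj₂ eq = inj₂ (trans eq (sym (Vec.lookup∘update′ w≢v g _)))
...   | inj₁ w∈ with shrink w∈
...     | inj₁ w≡v = ⊥-elim (w≢v w≡v)
...     | inj₂ w∈R′ = inj₁ w∈R′

-- With `suc k` vertices left, `suc k` choices of a vertex, `t * suc k` choices of its image in the
-- hitting set, and recursion for the others. The outer `suc` makes the bound visibly positive, as
-- the case of an empty list with arbitrary `k` requires.
extensions : ℕ → ℕ → ℕ
extensions t zero = 1
extensions t (suc k) = suc (suc k * (t * suc k * extensions t k))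

extensions≥1 : ∀ t k → 1 ≤ extensions t k
extensions≥1 t zero = ℕ.≤-refl
extensions≥1 t (suc k) = s≤s z≤n

module Upper {T G : Graph} (R : Rooting T) {s t : ℕ} (1≤s : 1 ≤ s) (1≤t : 1 ≤ t) (¬minor : ¬ Minor (K (suc s) t) G) where

  High : List (V T) → Set
  High U = ∀ {v} → v ∈ U → suc s ≤ degree T v

  extends? : ∀ U g e → Dec (IsEmb T G e × AgreeOff U e g)
  extends? U g e = isEmb? T G e ×-dec Fin.all? (λ v → (v ∈? U) ⊎-dec (lookup e v Fin.≟ lookup g v))
    where open DecMembership (Fin._≟_ {n T}) using (_∈?_)

  -- Fixing the image of one `u` leaves a shorter list that is again `High`, because degrees are
  -- taken in all of `T`. So the alternative of `disjoint-or-hit` can be applied again until `U` is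
  -- empty.
  few-extensions : ∀ k (U : List (V T)) → length U ≤ k → High U → (g : Vec (V G) (n T)) →
    Cover (λ e → IsEmb T G e × AgreeOff U e g) (extensions t k)
  few-extensions k [] _ _ g = g ∷ [] , extensions≥1 t k , λ {e} (_ , agree) → here (lookup-ext (off {e} agree))
    where
    off : ∀ {e} → AgreeOff [] e g → ∀ v → lookup e v ≡ lookup g v
    off agree v with agree v
    ... | inj₂ eq = eq
  few-extensions (suc k) U@(u₀ ∷ _) le high g
    with disjoint-or-hit Fin._≟_ (λ e → map (lookup e) U) (λ e → ℕ.≤-trans (ℕ.≤-reflexive (List.length-map (lookup e) U)) le) L t
    where
    L = List.filter (extends? U g) (allVecs (allFin (n G)) (n T))
  ... | inj₁ (f , f∈ , disj) = ⊥-elim (¬minor (hub⇒minor (FindHub.hub R 1≤s U high (here refl)) 1≤t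
      (lookup ∘ f) (proj₁ ∘ extends) same λ {i} {j} i≢j {u} {v} u∈ v∈ eq →
        disj i≢j (∈.∈-map⁺ (lookup (f i)) u∈) (subst (_∈ map (lookup (f j)) U) (sym eq) (∈.∈-map⁺ (lookup (f j)) v∈))))
    where
    extends : ∀ i → IsEmb T G (f i) × AgreeOff U (f i) g
    extends i = proj₂ (∈.∈-filter⁻ (extends? U g)
      {xs = allVecs (allFin (n G)) (n T)} (f∈ i))
    off : ∀ i {v} → v ∉ U → lookup (f i) v ≡ lookup g v
    off i {v} v∉ with proj₂ (extends i) v
    ... | inj₁ v∈ = ⊥-elim (v∉ v∈)
    ... | inj₂ eq = eq
    same : ∀ i j {v} → v ∉ U → lookup (f i) v ≡ lookup (f j) v
    same i j v∉ = trans (off i v∉) (sym (off j v∉))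
  ... | inj₂ (H , len , hit) = cover-⊆ (λ {e} → locate {e}) (ℕ.≤-trans (ℕ.*-mono-≤ le (ℕ.*-monoˡ-≤ _ len)) (ℕ.n≤1+n _))
      (cover-⋃ U λ {u} u∈ → cover-⋃ H λ {h} _ → few-extensions k (U - u) (shorter u∈) (high ∘ -⊆) (g Vec.[ u ]≔ h))
    where
    _-_ : List (V T) → V T → List (V T)
    W - u = List.filter (λ v → ¬? (v Fin.≟ u)) W
    -⊆ : ∀ {u v} → v ∈ U - u → v ∈ U
    -⊆ {u} v∈ = proj₁ (∈.∈-filter⁻ (λ v → ¬? (v Fin.≟ u)) {xs = U} v∈)
    shorter : ∀ {u} → u ∈ U → length (U - u) ≤ k
    shorter {u} u∈ = ℕ.≤-pred (ℕ.≤-trans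
      (List.filter-notAll (λ v → ¬? (v Fin.≟ u)) U (Any.map (λ { refl ne → ne refl }) u∈)) le)
    shrink : ∀ u {v} → v ∈ U → v ≡ u ⊎ v ∈ U - u
    shrink u {v} v∈ with v Fin.≟ u
    ... | yes eq = inj₁ eq
    ... | no ne = inj₂ (∈.∈-filter⁺ (λ v → ¬? (v Fin.≟ u)) v∈ ne)
    locate : ∀ {e} → IsEmb T G e × AgreeOff U e g →
      ∃ λ u → u ∈ U × ∃ λ h → h ∈ H × IsEmb T G e × AgreeOff (U - u) e (g Vec.[ u ]≔ h)
    locate {e} (emb , agree)
      with h , h∈ , h∈im ← hit (∈.∈-filter⁺ (extends? U g)
        (∈-allVecs e (λ i → ∈.∈-allFin (lookup e i))) (emb , agree))
      with u , u∈ , refl ← ∈.∈-map⁻ (lookup e) h∈im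
      = u , u∈ , h , h∈ , emb , agree-update e g u (shrink u) agree

  module _ {M : ℕ} (cliques : Cover (Clique G) M) where

    ends : List (V T × V T) → List (V T) → List (V T)
    ends [] U = U
    ends ((v , p) ∷ Q) U = v ∷ p ∷ ends Q U

    -- An embedding sends an edge `(v , p)` to an edge and a pair with `v ≡ p` to a diagonal pair.
    -- Either way the image is in the list of cliques, so each entry of `Q` costs one factor `M`.
    few-embeddings-off : (U : List (V T)) → High U → (Q : List (V T × V T)) →
      (∀ {v p} → (v , p) ∈ Q → v ≡ p ⊎ adj T v p ≡ true) → (g : Vec (V G) (n T)) →
      Cover (λ e → IsEmb T G e × AgreeOff (ends Q U) e g) (M ^ length Q * extensions t (length U))
    few-embeddings-off U high [] _ g = cover-⊆ id (ℕ.≤-reflexive (sym (ℕ.*-identityˡ _)))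
      (few-extensions (length U) U ℕ.≤-refl high g)
    few-embeddings-off U high ((v , p) ∷ Q) Q-cliques g =
      cover-⊆ (λ {e} → locate {e}) (ℕ.≤-trans (ℕ.*-monoˡ-≤ _ len) (ℕ.≤-reflexive (sym (ℕ.*-assoc M (M ^ length Q) _))))
        (cover-⋃ L λ {(a , b)} _ → few-embeddings-off U high Q (Q-cliques ∘ there) ((g Vec.[ v ]≔ a) Vec.[ p ]≔ b))
      where
      L = proj₁ cliques
      len = proj₁ (proj₂ cliques)
      cov = proj₂ (proj₂ cliques)
      uncons : ∀ {x w : V T} {R} → w ∈ x ∷ R → w ≡ x ⊎ w ∈ R
      uncons (here eq) = inj₁ eq
      uncons (there w∈) = inj₂ w∈
      image-clique : ∀ {e} → IsEmb T G e → lookup e v ≡ lookup e p ⊎ adj G (lookup e v) (lookup e p) ≡ true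
      image-clique {e} emb with Q-cliques (here refl)
      ... | inj₁ eq = inj₁ (cong (lookup e) eq)
      ... | inj₂ vp = inj₂ (IsEmbedding.edges emb vp)
      locate : ∀ {e} → IsEmb T G e × AgreeOff (v ∷ p ∷ ends Q U) e g →
        ∃ λ ((a , b) : V G × V G) → (a , b) ∈ L × IsEmb T G e × AgreeOff (ends Q U) e ((g Vec.[ v ]≔ a) Vec.[ p ]≔ b)
      locate {e} (emb , agree) = (lookup e v , lookup e p) , cov (image-clique {e} emb) , emb ,
        agree-update e (g Vec.[ v ]≔ lookup e v) p uncons (agree-update e g v uncons agree)

    high-vertices : List (V T)
    high-vertices = List.filter (λ v → suc s ℕ.≤? degree T v) (allFin (n T))

    few-embeddings : V G → 1 ≤ M → Cover (IsEmb T G) (M ^ α s T * extensions t (length high-vertices))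
    -- At the start every position is free, so the entries `x₀` are only placeholders.
    few-embeddings x₀ 1≤M = cover-⊆ (λ emb → emb , λ v → inj₁ (all-covered v)) fewer
      (few-embeddings-off U high Q Q-cliques (Vec.replicate (n T) x₀))
      where
      U = high-vertices
      F = List.filter (λ v → degree T v ℕ.≤? s) (allFin (n T))
      open StableCover (stable-cover R (length F) F ℕ.≤-refl)
      high : High U
      high v∈ = proj₂ (∈.∈-filter⁻ (λ v → suc s ℕ.≤? degree T v) {xs = allFin (n T)} v∈)
      ends⁺ : ∀ Q {v p x} → (v , p) ∈ Q → x ≡ v ⊎ x ≡ p → x ∈ ends Q U
      ends⁺ (_ ∷ Q) (here refl) (inj₁ refl) = here refl
      ends⁺ (_ ∷ Q) (here refl) (inj₂ refl) = there (here refl)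
      ends⁺ (_ ∷ Q) (there q∈) h = there (there (ends⁺ Q q∈ h))
      ends-U : ∀ Q {x} → x ∈ U → x ∈ ends Q U
      ends-U [] x∈ = x∈
      ends-U (_ ∷ Q) x∈ = there (there (ends-U Q x∈))
      all-covered : ∀ x → x ∈ ends Q U
      all-covered x with degree T x ℕ.≤? s
      ... | no ¬low = ends-U Q (∈.∈-filter⁺ (λ v → suc s ℕ.≤? degree T v) (∈.∈-allFin x) (ℕ.≰⇒> ¬low))
      ... | yes low with v , p , q∈ , h ← covers (∈.∈-filter⁺ (λ v → degree T v ℕ.≤? s) (∈.∈-allFin x) low) = ends⁺ Q q∈ h
      Q≤α : length Q ≤ α s T
      Q≤α = ℕ.≤-trans (ℕ.≤-reflexive same-size) (stable≤α s T S-unique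
        (λ x∈ → proj₂ (∈.∈-filter⁻ (λ v → degree T v ℕ.≤? s) {xs = allFin (n T)} (S⊆F x∈))) S-stable)
      fewer : M ^ length Q * extensions t (length U) ≤ M ^ α s T * extensions t (length U)
      fewer = ℕ.*-monoˡ-≤ _ (ℕ.^-monoʳ-≤ M {{>-nonZero 1≤M}} Q≤α)

-- Counting subgraphs

record IsCopy (H : Graph) {k : ℕ} (S : Subset k) (E : Vec (Vec Bool k) k) (g : V H → Fin k) : Set where
  field
    injective : ∀ {u v} → g u ≡ g v → u ≡ v
    onto : ∀ {x} → lookup S x ≡ true → ∃ λ u → g u ≡ x
    into : ∀ u → lookup S (g u) ≡ true
    edges : ∀ u v → adj H u v ≡ lookup (lookup E (g u)) (g v)

isoTo⁻ : (H : Graph) {k : ℕ} (S : Subset k) (E : Vec (Vec Bool k) k) → IsoTo H (S , E) ≡ true → ∃ (IsCopy H S E)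
isoTo⁻ H {k} S E h with g , _ , ok ← any⁻ _ (allFuns (n H) k) h
  with inj , rest ← ∧⁻ {∀ᵇ λ u → ∀ᵇ λ v → (g u == g v) ⇒ᵇ (u == v)} ok
  with img , es ← ∧⁻ {∀ᵇ λ x → lookup S x ⇔ᵇ (∃ᵇ λ u → g u == x)} rest
  = g , record
  { injective = λ {u} {v} eq → ==⁻ (⇒ᵇ⁻ {g u == g v} (∀ᵇ⁻ (∀ᵇ⁻ inj u) v) (==⁺ eq))
  ; onto = λ {x} x∈ → let u , eq = ∃ᵇ⁻ (trans (sym (in-image x)) x∈) in u , ==⁻ eq
  ; into = λ u → trans (in-image (g u)) (∃ᵇ⁺ u (==-refl (g u)))
  ; edges = λ u v → ⇔ᵇ⁻ {adj H u v} (∀ᵇ⁻ (∀ᵇ⁻ es u) v)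
  }
  where
  in-image : ∀ x → lookup S x ≡ (∃ᵇ λ u → g u == x)
  in-image x = ⇔ᵇ⁻ {lookup S x} (∀ᵇ⁻ img x)

isoTo⁺ : (H : Graph) {k : ℕ} (S : Subset k) (E : Vec (Vec Bool k) k) {g : V H → Fin k} → IsCopy H S E g →
  IsoTo H (S , E) ≡ true
isoTo⁺ H {k} S E {g} copy with f , f∈ , f≗g ← ∈-allFuns (n H) k g = any⁺ _ f∈ (∧⁺ inj (∧⁺ img es))
  where
  open IsCopy copy
  inj : (∀ᵇ λ u → ∀ᵇ λ v → (f u == f v) ⇒ᵇ (u == v)) ≡ true
  inj = ∀ᵇ⁺ λ u → ∀ᵇ⁺ λ v → ⇒ᵇ⁺ {f u == f v} λ eq →
    ==⁺ (injective (trans (sym (f≗g u)) (trans (==⁻ eq) (f≗g v))))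
  img : (∀ᵇ λ x → lookup S x ⇔ᵇ (∃ᵇ λ u → f u == x)) ≡ true
  img = ∀ᵇ⁺ λ x → ⇔ᵇ⁺ {lookup S x} {∃ᵇ λ u → f u == x} (bool-ext
    (λ x∈ → let u , eq = onto x∈ in ∃ᵇ⁺ u (==⁺ (trans (f≗g u) eq)))
    (λ h → let u , eq = ∃ᵇ⁻ h in subst (λ y → lookup S y ≡ true) (trans (sym (f≗g u)) (==⁻ eq)) (into u)))
  es : (∀ᵇ λ u → ∀ᵇ λ v → adj H u v ⇔ᵇ lookup (lookup E (f u)) (f v)) ≡ true
  es = ∀ᵇ⁺ λ u → ∀ᵇ⁺ λ v → ⇔ᵇ⁺ (trans (edges u v)
    (cong₂ (λ a b → lookup (lookup E a) b) (sym (f≗g u)) (sym (f≗g v))))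

isSubgraph⁻ : (G : Graph) (S : Subset (n G)) (E : Vec (Vec Bool (n G)) (n G)) → IsSubgraph G (S , E) ≡ true →
  ∀ {x y} → lookup (lookup E x) y ≡ true → adj G x y ≡ true × lookup S x ≡ true × lookup S y ≡ true
isSubgraph⁻ G S E h {x} {y} xy
  with _ , h ← ∧⁻ {lookup (lookup E x) y ⇔ᵇ lookup (lookup E y) x} (∀ᵇ⁻ (∀ᵇ⁻ h x) y)
  with _ , h ← ∧⁻ {not (lookup (lookup E x) x)} h
  with g , ss ← ∧⁻ {adj G x y} (⇒ᵇ⁻ {lookup (lookup E x) y} h xy) = g , ∧⁻ ss

isSubgraph⁺ : (G : Graph) (S : Subset (n G)) (E : Vec (Vec Bool (n G)) (n G)) →
  (∀ x y → lookup (lookup E x) y ≡ true → lookup (lookup E y) x ≡ true) →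
  (∀ {x y} → lookup (lookup E x) y ≡ true → adj G x y ≡ true × lookup S x ≡ true × lookup S y ≡ true) →
  IsSubgraph G (S , E) ≡ true
isSubgraph⁺ G S E swap h = ∀ᵇ⁺ λ x → ∀ᵇ⁺ λ y → ∧⁺ {lookup (lookup E x) y ⇔ᵇ lookup (lookup E y) x}
  (⇔ᵇ⁺ (bool-ext (swap x y) (swap y x)))
  (∧⁺ (not⁺ λ xx → adj⇒≢ G (proj₁ (h xx)) refl)
    (⇒ᵇ⁺ {lookup (lookup E x) y} λ xy → let g , sx , sy = h xy in ∧⁺ g (∧⁺ sx sy)))

allSubgraphData : ∀ k → List (SubgraphData k)
allSubgraphData k = concatMap (λ S → map (S ,_) (allVecs (allVecs allBools k) k)) (allVecs allBools k)

∈-allSubgraphData : ∀ {k} (d : SubgraphData k) → d ∈ allSubgraphData k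
∈-allSubgraphData (S , E) = ∈-concatMap⁺ _ (∈-allVecs S (λ _ → ∈-allBools _))
  (∈.∈-map⁺ (S ,_) (∈-allVecs E (λ i → ∈-allVecs (lookup E i) (λ _ → ∈-allBools _))))

allBools-unique : Unique allBools
allBools-unique = ((λ ()) ∷ []) ∷ [] ∷ []

allSubgraphData-unique : ∀ k → Unique (allSubgraphData k)
allSubgraphData-unique k = concatMap-unique _ proj₁
  (λ b∈ → let _ , _ , eq = ∈.∈-map⁻ _ b∈ in cong proj₁ eq)
  (λ S → Unique.map⁺ (cong proj₂) (allVecs-unique k (allVecs-unique k allBools-unique)))
  (allVecs-unique k allBools-unique)

copies≥ : (H G : Graph) (L : List (SubgraphData (n G))) → Unique L →
  (∀ {d} → d ∈ L → IsSubgraph G d ≡ true × IsoTo H d ≡ true) → length L ≤ C H G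
copies≥ H G L u h = unique-⊆⇒length-≤ u
  (filterᵇ (λ d → IsSubgraph G d ∧ IsoTo H d) (allSubgraphData (n G)))
  λ {d} d∈ → let p , q = h d∈ in ∈-filterᵇ⁺ _ (∈-allSubgraphData d) (∧⁺ p q)

image-subgraph : (H : Graph) {k : ℕ} → Vec (Fin k) (n H) → SubgraphData k
image-subgraph H e = Vec.tabulate (λ x → ∃ᵇ λ u → lookup e u == x) ,
  Vec.tabulate λ x → Vec.tabulate λ y → ∃ᵇ λ u → ∃ᵇ λ v → (lookup e u == x) ∧ (lookup e v == y) ∧ adj H u v

-- An entry of `E` forces both of its ends into `S`, hence into the image of the isomorphism. So `E`
-- has no entries beyond those coming from edges of `H`.
copy⇒image : (H G : Graph) (d : SubgraphData (n G)) → IsSubgraph G d ≡ true → IsoTo H d ≡ true →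
  ∃ λ e → IsEmb H G e × d ≡ image-subgraph H e
copy⇒image H G (S , E) sub iso with g , copy ← isoTo⁻ H S E iso =
  e , record { injective = λ {u} {v} eq → injective (trans (sym (e≗g u)) (trans eq (e≗g v)))
             ; edges = λ {u} {v} uv → subst₂ (λ a b → adj G a b ≡ true) (sym (e≗g u)) (sym (e≗g v))
                 (proj₁ (isSubgraph⁻ G S E sub (trans (sym (edges u v)) uv))) } ,
  cong₂ _,_ (lookup-ext λ x → trans (vertices x) (sym (Vec.lookup∘tabulate _ x)))
    (lookup-ext λ x → lookup-ext λ y → trans (edges-eq x y)
      (sym (trans (cong (λ r → lookup r y) (Vec.lookup∘tabulate _ x)) (Vec.lookup∘tabulate _ y))))
  where
  open IsCopy copy
  e = Vec.tabulate g
  e≗g : ∀ u → lookup e u ≡ g u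
  e≗g = Vec.lookup∘tabulate g
  vertices : ∀ x → lookup S x ≡ (∃ᵇ λ u → lookup e u == x)
  vertices x = bool-ext
    (λ x∈ → let u , eq = onto x∈ in ∃ᵇ⁺ u (==⁺ (trans (e≗g u) eq)))
    (λ h → let u , eq = ∃ᵇ⁻ h in subst (λ y → lookup S y ≡ true) (trans (sym (e≗g u)) (==⁻ eq)) (into u))
  edges-eq : ∀ x y → lookup (lookup E x) y ≡ (∃ᵇ λ u → ∃ᵇ λ v → (lookup e u == x) ∧ (lookup e v == y) ∧ adj H u v)
  edges-eq x y = bool-ext to from
    where
    to : lookup (lookup E x) y ≡ true → (∃ᵇ λ u → ∃ᵇ λ v → (lookup e u == x) ∧ (lookup e v == y) ∧ adj H u v) ≡ true
    to xy with _ , sx , sy ← isSubgraph⁻ G S E sub xy with u , p ← onto {x} sx with v , q ← onto {y} sy =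
      ∃ᵇ⁺ u (∃ᵇ⁺ v (∧⁺ (==⁺ (trans (e≗g u) p)) (∧⁺ (==⁺ (trans (e≗g v) q))
        (trans (edges u v) (trans (cong₂ (λ a b → lookup (lookup E a) b) p q) xy)))))
    from : (∃ᵇ λ u → ∃ᵇ λ v → (lookup e u == x) ∧ (lookup e v == y) ∧ adj H u v) ≡ true → lookup (lookup E x) y ≡ true
    from h with u , h ← ∃ᵇ⁻ h with v , h ← ∃ᵇ⁻ h
      with p , h ← ∧⁻ {lookup e u == x} h with q , uv ← ∧⁻ {lookup e v == y} h =
      subst₂ (λ a b → lookup (lookup E a) b ≡ true) (trans (sym (e≗g u)) (==⁻ p)) (trans (sym (e≗g v)) (==⁻ q))
        (trans (sym (edges u v)) uv)

copies≤ : (H G : Graph) {c : ℕ} → Cover (IsEmb H G) c → C H G ≤ c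
copies≤ H G cov = cover-length (cover-map (image-subgraph H) cov)
  (filterᵇ-unique _ (allSubgraphData-unique (n G)))
  λ {d} d∈ → let _ , h = ∈-filterᵇ⁻ (λ d → IsSubgraph G d ∧ IsoTo H d) {allSubgraphData (n G)} d∈
                 sub , iso = ∧⁻ {IsSubgraph G d} h
             in copy⇒image H G d sub iso

-- The upper bound

^-distribʳ-* : ∀ a b k → (a * b) ^ k ≡ a ^ k * b ^ k
^-distribʳ-* a b zero = refl
^-distribʳ-* a b (suc k) = trans (cong ((a * b) *_) (^-distribʳ-* a b k)) (ℕ.[m*n]*[o*p]≡[m*o]*[n*p] a b (a ^ k) (b ^ k))

upper-bound : (s t : ℕ) → 1 ≤ s → 1 ≤ t → (𝒢 : Graph → Set) → (∀ G H → 𝒢 G → Minor H G → 𝒢 H) → ¬ 𝒢 (K (1 + s) t) →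
  (T : Graph) → Rooting T → ∃ λ c → ∀ m → 1 ≤ m → ∀ G → 𝒢 G → n G ≡ m → C T G ≤ c * m ^ α s T
upper-bound s t 1≤s 1≤t 𝒢 closed ∉𝒢 T R
  -- `K (1 + s) t` is a minor of the complete graph on `1 + s + t` vertices, so that complete graph
  -- is excluded as well.
  with c , linear ← linear-edges (1 + s + t) 𝒢 closed (λ h → ∉𝒢 (closed _ _ h (minor-Complete (K (1 + s) t))))
  -- There are at most `(1 + c) * m` cliques, namely `m` diagonal pairs and `c * m` ordered edges.
  -- The factor `b` bounds the extensions to the vertices of degree above `s`.
  = (1 + c) ^ a * b , bound
  where
  a = α s T
  b = extensions t (length (List.filter (λ v → suc s ℕ.≤? degree T v) (allFin (n T))))
  bound : ∀ m → 1 ≤ m → ∀ G → 𝒢 G → n G ≡ m → C T G ≤ (1 + c) ^ a * b * m ^ a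
  bound m 1≤m G g refl = begin
    C T G                              ≤⟨ copies≤ T G (Upper.few-embeddings R 1≤s 1≤t (∉𝒢 ∘ closed _ _ g) cliques x₀ M≥1) ⟩
    ((1 + c) * m) ^ a * b              ≡⟨ cong (_* b) (^-distribʳ-* (1 + c) m a) ⟩
    (1 + c) ^ a * m ^ a * b            ≡⟨ ℕ.*-assoc ((1 + c) ^ a) (m ^ a) b ⟩
    (1 + c) ^ a * (m ^ a * b)          ≡⟨ cong ((1 + c) ^ a *_) (ℕ.*-comm (m ^ a) b) ⟩
    (1 + c) ^ a * (b * m ^ a)          ≡⟨ sym (ℕ.*-assoc ((1 + c) ^ a) b (m ^ a)) ⟩
    (1 + c) ^ a * b * m ^ a            ∎
    where
    open ℕ.≤-Reasoning
    x₀ = Fin.fromℕ< 1≤m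
    M≥1 : 1 ≤ (1 + c) * m
    M≥1 = ℕ.≤-trans 1≤m (ℕ.m≤m+n m (c * m))
    diagonal = map (λ x → x , x) (allFin m)
    edge-list = linear G g
    cliques : Cover (Clique G) ((1 + c) * m)
    cliques = diagonal ++ proj₁ edge-list , len , λ where
        (inj₁ refl) → ∈.∈-++⁺ˡ (∈.∈-map⁺ (λ x → x , x) (∈.∈-allFin _))
        (inj₂ e) → ∈.∈-++⁺ʳ diagonal (proj₂ (proj₂ edge-list) e)
      where
      len : length (diagonal ++ proj₁ edge-list) ≤ m + c * m
      len = ℕ.≤-trans (ℕ.≤-reflexive (List.length-++ diagonal)) (ℕ.+-mono-≤
        (ℕ.≤-reflexive (trans (List.length-map _ (allFin m)) (List.length-tabulate {n = m} id)))
        (proj₁ (proj₂ edge-list)))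

-- Blow-ups have small treewidth

-- The predecessor and the successor on the cycle, with the wrap-around at both ends; length at
-- least 3 makes them distinct.
cycle-neighbours : (G : Graph) {k : ℕ} (c : Fin (3 + k) → V G) →
  (∀ (i : Fin (2 + k)) → adj G (c (inject₁ i)) (c (suc i)) ≡ true) → adj G (c (fromℕ (2 + k))) (c zero) ≡ true →
  ∀ i → ∃ λ j → ∃ λ l → j ≢ l × adj G (c i) (c j) ≡ true × adj G (c i) (c l) ≡ true
cycle-neighbours G {k} c steps close zero =
  suc zero , fromℕ (2 + k) , (λ ()) , steps zero , trans (adj-sym G (c zero) _) close
cycle-neighbours G {k} c steps close i@(suc i′) with 2 + k ℕ.≟ toℕ i
... | yes last = inject₁ i′ , zero , i′≢0 , back , subst (λ j → adj G (c j) (c zero) ≡ true) (sym i≡last) close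
  where
  i≡last : i ≡ fromℕ (2 + k)
  i≡last = Fin.toℕ-injective (trans (sym last) (sym (Fin.toℕ-fromℕ (2 + k))))
  i′≢0 : inject₁ i′ ≢ zero
  i′≢0 eq with () ← trans (ℕ.suc-injective last) (trans (sym (Fin.toℕ-inject₁ i′)) (cong toℕ eq))
  back : adj G (c i) (c (inject₁ i′)) ≡ true
  back = trans (adj-sym G (c i) _) (steps i′)
... | no ¬last = inject₁ i′ , suc i″ , apart , back , forth
  where
  i″ = Fin.lower₁ i ¬last
  apart : inject₁ i′ ≢ suc i″
  apart eq = ℕ.m≢1+n+m (toℕ i′) {1} (trans (sym (Fin.toℕ-inject₁ i′))
    (trans (cong toℕ eq) (cong suc (Fin.toℕ-lower₁ i ¬last))))
  back : adj G (c i) (c (inject₁ i′)) ≡ true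
  back = trans (adj-sym G (c i) _) (steps i′)
  forth : adj G (c i) (c (suc i″)) ≡ true
  forth = subst (λ j → adj G (c j) (c (suc i″)) ≡ true) (Fin.inject₁-lower₁ i ¬last) (steps i″)

maximum : ∀ {k} (f : Fin (suc k) → ℕ) → ∃ λ i → ∀ j → f j ≤ f i
maximum {k} f = argmax f zero (allFin (suc k)) ,
  λ j → All.lookup (f[xs]≤f[argmax] {f = f} zero (allFin (suc k))) (∈.∈-allFin j)

module ParentTree {m : ℕ} (par : Fin m → Fin (suc m)) (rank : Fin (suc m) → ℕ)
  (par-rank : ∀ i → rank (par i) < rank (suc i)) where

  private
    is-parent : Fin (suc m) → Fin (suc m) → Bool
    is-parent zero _ = false
    is-parent (suc i) y = par i == y

    is-parent-rank : ∀ x y → is-parent x y ≡ true → rank y < rank x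
    is-parent-rank (suc i) y h = subst (λ z → rank z < rank (suc i)) (==⁻ {i = par i} {y} h) (par-rank i)

    is-parent-unique : ∀ x y z → is-parent x y ≡ true → is-parent x z ≡ true → y ≡ z
    is-parent-unique (suc i) y z hy hz = trans (sym (==⁻ {i = par i} {y} hy)) (==⁻ {i = par i} {z} hz)

    linked : Fin (suc m) → Fin (suc m) → Bool
    linked x y = is-parent x y ∨ is-parent y x

    linked⁻ : ∀ x y → linked x y ≡ true → is-parent x y ≡ true ⊎ is-parent y x ≡ true
    linked⁻ x y h with is-parent x y
    ... | true = inj₁ refl
    ... | false = inj₂ h

  tree : Graph
  tree = record
    { adj = linked
    ; adj-sym = λ x y → 𝔹.∨-comm (is-parent x y) (is-parent y x)
    ; adj-irr = λ x → 𝔹.¬-not λ h → irr x (linked⁻ x x h)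
    }
    where
    irr : ∀ x → ¬ (is-parent x x ≡ true ⊎ is-parent x x ≡ true)
    irr x (inj₁ h) = ℕ.<-irrefl refl (is-parent-rank x x h)
    irr x (inj₂ h) = ℕ.<-irrefl refl (is-parent-rank x x h)

  par-adj : ∀ i → adj tree (suc i) (par i) ≡ true
  par-adj i = cong (_∨ is-parent (par i) (suc i)) (==-refl (par i))

  private
    to-root : ∀ k x → rank x ≤ k → WalkIn tree (λ _ → ⊤) x zero
    to-root k zero _ = here tt
    to-root zero (suc i) le = ⊥-elim (ℕ.<⇒≱ (ℕ.≤-trans (s≤s z≤n) (par-rank i)) le)
    to-root (suc k) (suc i) le = step tt (par-adj i) (to-root k (par i) (ℕ.≤-pred (ℕ.≤-trans (par-rank i) le)))

    upward : ∀ x y → rank y ≤ rank x → linked x y ≡ true → is-parent x y ≡ true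
    upward x y le h with linked⁻ x y h
    ... | inj₁ p = p
    ... | inj₂ p = ⊥-elim (ℕ.<⇒≱ (is-parent-rank y x p) le)

    -- A vertex of maximal rank on a cycle would have two parents.
    acyclic : Forest tree
    acyclic (k , c , c-inj , steps , close) =
      let top , maximal = maximum (rank ∘ c)
          j , l , j≢l , ej , el = cycle-neighbours tree c steps close top
      in j≢l (c-inj {j} {l} (is-parent-unique (c top) (c j) (c l)
           (upward (c top) (c j) (maximal j) ej) (upward (c top) (c l) (maximal l) el)))

  is-tree : Tree tree
  is-tree = acyclic , (λ x y → walk-++ (to-root _ x ℕ.≤-refl) (walk-reverse (to-root _ y ℕ.≤-refl))) , s≤s z≤n

-- π maps every vertex of a blow-up of T to the vertex it is a copy of; only vertices in S have several copies.
record Blowup (T : Graph) (S : Subset (n T)) (q m : ℕ) : Set where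
  field
    π : Fin m → V T
    copy : V T → Fin (suc q) → Fin m
    π-copy : ∀ {v j} → lookup S v ≡ true ⊎ j ≡ zero → π (copy v j) ≡ v
    only-copy : ∀ {i} → lookup S (π i) ≢ true → copy (π i) zero ≡ i
    copy-injective : ∀ {v i j} → copy v i ≡ copy v j → i ≡ j

-- The tree has one node for each vertex of the blow-up and a root. The main copies `ι v` are linked
-- as in the rooted forest `T`, and any further copy hangs on the main copy of the same vertex. The
-- bag of a copy of a vertex in `S` adds all neighbours; any other bag adds at most the parent.
module BlowupTreewidth {T : Graph} (R : Rooting T) {s : ℕ} (1≤s : 1 ≤ s) {S : Subset (n T)}
  (low : ∀ {v} → lookup S v ≡ true → degree T v ≤ s)
  (stable : ∀ {u v} → lookup S u ≡ true → lookup S v ≡ true → adj T u v ≢ true)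
  {q m : ℕ} (B : Blowup T S q m) where
  open Rooting R
  open Blowup B

  private
    _∈S : V T → Set
    v ∈S = lookup S v ≡ true

    ι : V T → Fin m
    ι v = copy v zero

    πι : ∀ v → π (ι v) ≡ v
    πι v = π-copy (inj₂ refl)

    -- Roots of `T` hang on the additional node `zero` with an empty bag, which joins the components
    -- of `T` into one tree.
    above : Maybe (V T) → Fin (suc m)
    above (just p) = suc (ι p)
    above nothing = zero

    par : Fin m → Fin (suc m)
    par i with i Fin.≟ ι (π i)
    ... | yes _ = above (parent (π i))
    ... | no _ = suc (ι (π i))

    -- Ranks are shifted by one to make room for the node `zero`; further copies are placed above
    -- all main copies.
    level : Fin (suc m) → ℕ
    level zero = 0
    level (suc i) with i Fin.≟ ι (π i)
    ... | yes _ = suc (rank (π i))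
    ... | no _ = suc (n T)

    level-ι : ∀ v → level (suc (ι v)) ≡ suc (rank v)
    level-ι v with ι v Fin.≟ ι (π (ι v))
    ... | yes _ = cong (suc ∘ rank) (πι v)
    ... | no ne = ⊥-elim (ne (cong ι (sym (πι v))))

    par-level : ∀ i → level (par i) < level (suc i)
    par-level i with i Fin.≟ ι (π i)
    ... | no _ = ℕ.≤-trans (ℕ.≤-reflexive (cong suc (level-ι (π i)))) (s≤s (rank<n (π i)))
    ... | yes _ with parent (π i) in eq
    ...   | nothing = s≤s z≤n
    ...   | just p = ℕ.≤-trans (ℕ.≤-reflexive (cong suc (level-ι p))) (s≤s (parent-rank eq))

    open ParentTree par level par-level

    par-copy : ∀ {i} → i ≢ ι (π i) → par i ≡ suc (ι (π i))
    par-copy {i} ne with i Fin.≟ ι (π i)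
    ... | yes eq = ⊥-elim (ne eq)
    ... | no _ = refl

    par-main : ∀ {i p} → i ≡ ι (π i) → parent (π i) ≡ just p → par i ≡ suc (ι p)
    par-main {i} eq h with i Fin.≟ ι (π i)
    ... | yes _ = cong above h
    ... | no ne = ⊥-elim (ne eq)

    Below : Fin m → Fin m → Set
    Below i x = π i ∈S ⊎ parent (π i) ≡ just (π x)

    -- A copy of a vertex in `S` lies in its own bag only. This keeps all bags free of multiple
    -- copies and makes the subtree condition trivial for such copies.
    InBag : Fin m → Fin m → Set
    InBag i x = x ≡ i ⊎ (¬ π x ∈S × adj T (π i) (π x) ≡ true × Below i x)

    inBag? : ∀ i x → Dec (InBag i x)
    inBag? i x = (x Fin.≟ i) ⊎-dec (¬? (lookup S (π x) 𝔹.≟ true) ×-dec ((adj T (π i) (π x) 𝔹.≟ true) ×-dec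
      ((lookup S (π i) 𝔹.≟ true) ⊎-dec Maybe.≡-dec Fin._≟_ (parent (π i)) (just (π x)))))

    bag : Fin (suc m) → Subset m
    bag zero = Subset.⊥
    bag (suc i) = Vec.tabulate (λ x → does (inBag? i x))

    bag⁺ : ∀ {i x} → InBag i x → x Subset.∈ bag (suc i)
    bag⁺ {i} {x} h = Vec.lookup⇒[]= x _ (trans (Vec.lookup∘tabulate _ x) (dec-true (inBag? i x) h))

    lookup-bag⁻ : ∀ {i x} → lookup (bag (suc i)) x ≡ true → InBag i x
    lookup-bag⁻ {i} {x} h = dec⁻ (inBag? i x) (trans (sym (Vec.lookup∘tabulate _ x)) h)

    bag⁻ : ∀ {i x} → x Subset.∈ bag (suc i) → InBag i x
    bag⁻ h = lookup-bag⁻ (Vec.[]=⇒lookup h)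

    adjacent-bags : ∀ {i x} → i ≡ ι (π i) → x ≡ ι (π x) → adj T (π i) (π x) ≡ true → adj tree (suc i) (suc x) ≡ true
    adjacent-bags {i} {x} i-main x-main e with edge e
    ... | inj₁ h = subst (λ y → adj tree (suc i) y ≡ true) (trans (par-main i-main h) (cong suc (sym x-main))) (par-adj i)
    ... | inj₂ h = trans (adj-sym tree (suc i) (suc x))
      (subst (λ y → adj tree (suc x) y ≡ true) (trans (par-main x-main h) (cong suc (sym i-main))) (par-adj x))

    -- A vertex `x` in a foreign bag is the only copy of its vertex. If the bag belongs to a main
    -- copy, its node is linked to that of `x`. If it belongs to a further copy, the walk passes
    -- through the main copy, whose bag contains `x` for the same reason.
    to-own-bag : ∀ x t → x Subset.∈ bag t → WalkIn tree (λ t → x Subset.∈ bag t) t (suc x)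
    to-own-bag x zero h = ⊥-elim (Subset.∉⊥ h)
    to-own-bag x (suc i) h with bag⁻ h
    ... | inj₁ refl = here h
    ... | inj₂ (x∉S , e , b) with i Fin.≟ ι (π i)
    ...   | yes i-main = step h (adjacent-bags i-main (sym (only-copy x∉S)) e) (here (bag⁺ (inj₁ refl)))
    ...   | no i-copy = step h (subst (λ y → adj tree (suc i) y ≡ true) (par-copy i-copy) (par-adj i))
            (step (bag⁺ (inj₂ (x∉S , e′ , b′)))
              (adjacent-bags (cong ι (sym (πι (π i)))) (sym (only-copy x∉S)) e′) (here (bag⁺ (inj₁ refl))))
      where
      e′ : adj T (π (ι (π i))) (π x) ≡ true
      e′ = subst (λ v → adj T v (π x) ≡ true) (sym (πι (π i))) e
      b′ : Below (ι (π i)) x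
      b′ = subst (λ v → v ∈S ⊎ parent v ≡ just (π x)) (sym (πι (π i))) b

    up-to : Maybe (V T) → List (Fin m)
    up-to (just p) = ι p ∷ []
    up-to nothing = []

    short : ∀ p → length (up-to p) ≤ 1
    short (just _) = ℕ.≤-refl
    short nothing = z≤n

    bag-in-star : ∀ {i x} → InBag i x → x ∈ i ∷ map ι (neighbours T (π i))
    bag-in-star (inj₁ eq) = here eq
    bag-in-star {i} (inj₂ (x∉S , e , _)) =
      there (subst (_∈ map ι (neighbours T (π i))) (only-copy x∉S) (∈.∈-map⁺ ι (neighbours⁺ T e)))

    bag-in-edge : ∀ {i x} → ¬ π i ∈S → InBag i x → x ∈ i ∷ up-to (parent (π i))
    bag-in-edge _ (inj₁ eq) = here eq
    bag-in-edge i∉S (inj₂ (_ , _ , inj₁ i∈S)) = ⊥-elim (i∉S i∈S)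
    bag-in-edge _ (inj₂ (x∉S , _ , inj₂ h)) rewrite h = there (here (sym (only-copy x∉S)))

    small-bag : ∀ i → Dec (π i ∈S) → ∣ bag (suc i) ∣ ≤ suc s
    small-bag i (yes i∈S) = ℕ.≤-trans (∣S∣≤length (bag (suc i)) (i ∷ map ι (neighbours T (π i))) (bag-in-star ∘ lookup-bag⁻))
      (s≤s (ℕ.≤-trans (ℕ.≤-reflexive (List.length-map ι (neighbours T (π i)))) (low i∈S)))
    small-bag i (no i∉S) = ℕ.≤-trans (∣S∣≤length (bag (suc i)) (i ∷ up-to (parent (π i))) (bag-in-edge i∉S ∘ lookup-bag⁻))
      (s≤s (ℕ.≤-trans (short (parent (π i))) 1≤s))

    small : ∀ t → ∣ bag t ∣ ≤ suc s
    small zero = ℕ.≤-trans (ℕ.≤-reflexive (Subset.∣⊥∣≡0 m)) z≤n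
    small (suc i) = small-bag i (lookup S (π i) 𝔹.≟ true)

    cover-e : ∀ x y → adj T (π x) (π y) ≡ true → ∃ λ t → x Subset.∈ bag t × y Subset.∈ bag t
    cover-e x y e = go (lookup S (π x) 𝔹.≟ true) (lookup S (π y) 𝔹.≟ true)
      where
      e′ = trans (adj-sym T (π y) (π x)) e
      at-x : ¬ π y ∈S → Below x y → ∃ λ t → x Subset.∈ bag t × y Subset.∈ bag t
      at-x y∉S b = suc x , bag⁺ (inj₁ refl) , bag⁺ (inj₂ (y∉S , e , b))
      at-y : ¬ π x ∈S → Below y x → ∃ λ t → x Subset.∈ bag t × y Subset.∈ bag t
      at-y x∉S b = suc y , bag⁺ (inj₂ (x∉S , e′ , b)) , bag⁺ (inj₁ refl)
      go : Dec (π x ∈S) → Dec (π y ∈S) → ∃ λ t → x Subset.∈ bag t × y Subset.∈ bag t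
      go (yes x∈S) _ = at-x (λ y∈S → stable x∈S y∈S e) (inj₁ x∈S)
      go (no x∉S) (yes y∈S) = at-y x∉S (inj₁ y∈S)
      go (no x∉S) (no y∉S) with edge e
      ... | inj₁ h = at-x y∉S (inj₂ h)
      ... | inj₂ h = at-y x∉S (inj₂ h)

  decomposition : TreewidthAtMost s (pull T π)
  decomposition = record
    { D = tree ; D-tree = is-tree ; bag = bag
    ; cover-v = λ x → suc x , bag⁺ (inj₁ refl)
    ; cover-e = cover-e
    ; subtree = λ x t₁ t₂ h₁ h₂ → walk-++ (to-own-bag x t₁ h₁) (walk-reverse (to-own-bag x t₂ h₂))
    ; width = small
    }

-- Counting in blow-ups

map-unique-on : {A B : Set} (f : A → B) {xs : List A} → (∀ {x y} → x ∈ xs → y ∈ xs → f x ≡ f y → x ≡ y) →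
  Unique xs → Unique (map f xs)
map-unique-on f inj [] = []
map-unique-on f inj (ne ∷ u) =
  All.map⁺ (All.tabulate λ y∈ eq → All.lookup ne y∈ (inj (here refl) (there y∈) eq)) ∷
  map-unique-on f (λ x∈ y∈ → inj (there x∈) (there y∈)) u

embedding⇒copy : (H G : Graph) (e : Vec (V G) (n H)) → IsEmb H G e →
  IsSubgraph G (image-subgraph H e) ≡ true × IsoTo H (image-subgraph H e) ≡ true
embedding⇒copy H G e emb = isSubgraph⁺ G S E swap inside , isoTo⁺ H S E copy
  where
  open IsEmbedding emb
  S = proj₁ (image-subgraph H e)
  E = proj₂ (image-subgraph H e)
  S⁺ : ∀ u → lookup S (lookup e u) ≡ true
  S⁺ u = trans (Vec.lookup∘tabulate _ (lookup e u)) (∃ᵇ⁺ u (==-refl (lookup e u)))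
  S⁻ : ∀ {x} → lookup S x ≡ true → ∃ λ u → lookup e u ≡ x
  S⁻ {x} h with u , eq ← ∃ᵇ⁻ (trans (sym (Vec.lookup∘tabulate _ x)) h) = u , ==⁻ eq
  lookup-E : ∀ x y → lookup (lookup E x) y ≡ (∃ᵇ λ u → ∃ᵇ λ v → (lookup e u == x) ∧ (lookup e v == y) ∧ adj H u v)
  lookup-E x y = trans (cong (λ r → lookup r y) (Vec.lookup∘tabulate _ x)) (Vec.lookup∘tabulate _ y)
  E⁺ : ∀ u v → adj H u v ≡ true → lookup (lookup E (lookup e u)) (lookup e v) ≡ true
  E⁺ u v uv = trans (lookup-E (lookup e u) (lookup e v))
    (∃ᵇ⁺ u (∃ᵇ⁺ v (∧⁺ (==-refl (lookup e u)) (∧⁺ (==-refl (lookup e v)) uv))))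
  E⁻ : ∀ x y → lookup (lookup E x) y ≡ true → ∃ λ u → ∃ λ v → lookup e u ≡ x × lookup e v ≡ y × adj H u v ≡ true
  E⁻ x y h with u , h ← ∃ᵇ⁻ (trans (sym (lookup-E x y)) h) with v , h ← ∃ᵇ⁻ h
    with p , h ← ∧⁻ {lookup e u == x} h with q , uv ← ∧⁻ {lookup e v == y} h = u , v , ==⁻ p , ==⁻ q , uv
  swap : ∀ x y → lookup (lookup E x) y ≡ true → lookup (lookup E y) x ≡ true
  swap x y h with u , v , refl , refl , uv ← E⁻ x y h = E⁺ v u (trans (adj-sym H v u) uv)
  inside : ∀ {x y} → lookup (lookup E x) y ≡ true → adj G x y ≡ true × lookup S x ≡ true × lookup S y ≡ true
  inside {x} {y} h with u , v , refl , refl , uv ← E⁻ x y h = edges uv , S⁺ u , S⁺ v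
  E-edges : ∀ u v → lookup (lookup E (lookup e u)) (lookup e v) ≡ true → adj H u v ≡ true
  E-edges u v h with u′ , v′ , p , q , uv ← E⁻ (lookup e u) (lookup e v) h =
    subst₂ (λ a b → adj H a b ≡ true) (injective p) (injective q) uv
  copy : IsCopy H S E (lookup e)
  copy = record { injective = injective ; onto = S⁻ ; into = S⁺ ; edges = λ u v → bool-ext (E⁺ u v) (E-edges u v) }

-- One copy index per vertex; outside `S` it is fixed to `zero`, the index of the only copy.
choices : ∀ {k} (q : ℕ) → Subset k → List (Vec (Fin (suc q)) k)
choices q [] = [] ∷ []
choices q (true ∷ S) = concatMap (λ f → map (_∷ f) (allFin (suc q))) (choices q S)
choices q (false ∷ S) = map (zero ∷_) (choices q S)

choices-unique : ∀ {k} q (S : Subset k) → Unique (choices q S)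
choices-unique q [] = [] ∷ []
choices-unique q (true ∷ S) = concatMap-unique _ Vec.tail
  (λ b∈ → let _ , _ , eq = ∈.∈-map⁻ _ b∈ in cong Vec.tail eq)
  (λ f → Unique.map⁺ (cong Vec.head) (Unique.allFin⁺ (suc q))) (choices-unique q S)
choices-unique q (false ∷ S) = Unique.map⁺ (cong Vec.tail) (choices-unique q S)

choices-off : ∀ {k} q (S : Subset k) {f} → f ∈ choices q S → ∀ v → lookup S v ≡ true ⊎ lookup f v ≡ zero
choices-off q (true ∷ S) f∈ zero = inj₁ refl
choices-off q (true ∷ S) f∈ (suc v) with g , g∈ , f∈g ← ∈-concatMap⁻ _ (choices q S) f∈
  with _ , _ , refl ← ∈.∈-map⁻ (_∷ g) f∈g = choices-off q S g∈ v
choices-off q (false ∷ S) f∈ v with g , g∈ , refl ← ∈.∈-map⁻ (zero ∷_) f∈ with v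
... | zero = inj₂ refl
... | suc v = choices-off q S g∈ v

length-choices : ∀ {k} q (S : Subset k) → suc q ^ ∣ S ∣ ≤ length (choices q S)
length-choices q [] = ℕ.≤-refl
length-choices q (true ∷ S) = begin
  suc q * suc q ^ ∣ S ∣          ≤⟨ ℕ.*-monoʳ-≤ (suc q) (length-choices q S) ⟩
  suc q * length (choices q S)   ≡⟨ ℕ.*-comm (suc q) _ ⟩
  length (choices q S) * suc q   ≤⟨ length-concatMap-≥ (λ f → map (_∷ f) (allFin (suc q))) many (choices q S) ⟩
  length (choices q (true ∷ S))  ∎
  where
  open ℕ.≤-Reasoning
  many : ∀ f → suc q ≤ length (map (_∷ f) (allFin (suc q)))
  many f = ℕ.≤-reflexive (sym (trans (List.length-map (_∷ f) (allFin (suc q))) (List.length-tabulate {n = suc q} id)))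
length-choices q (false ∷ S) = ℕ.≤-trans (length-choices q S) (ℕ.≤-reflexive (sym (List.length-map (zero ∷_) (choices q S))))

-- `π` sends the copy chosen for `v` back to `v`. So each choice is an embedding, and the vertex set
-- of its image alone reveals the choice.
blowup-copies : {T : Graph} {S : Subset (n T)} {q m : ℕ} (B : Blowup T S q m) →
  suc q ^ ∣ S ∣ ≤ C T (pull T (Blowup.π B))
blowup-copies {T} {S} {q} {m} B = ℕ.≤-trans (length-choices q S) (ℕ.≤-trans
  (ℕ.≤-reflexive (sym (List.length-map subgraph (choices q S))))
  (copies≥ T G (map subgraph (choices q S)) (map-unique-on subgraph subgraph-injective (choices-unique q S))
    λ d∈ → let f , f∈ , eq = ∈.∈-map⁻ subgraph d∈
           in subst (λ d → IsSubgraph G d ≡ true × IsoTo T d ≡ true) (sym eq) (embedding⇒copy T G (place f) (place-embedding f∈))))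
  where
  open Blowup B
  G = pull T π
  place : Vec (Fin (suc q)) (n T) → Vec (Fin m) (n T)
  place f = Vec.tabulate λ v → copy v (lookup f v)
  lookup-place : ∀ f v → lookup (place f) v ≡ copy v (lookup f v)
  lookup-place f = Vec.lookup∘tabulate _
  subgraph : Vec (Fin (suc q)) (n T) → SubgraphData m
  subgraph f = image-subgraph T (place f)
  π-place : ∀ {f} → f ∈ choices q S → ∀ v → π (lookup (place f) v) ≡ v
  π-place {f} f∈ v = trans (cong π (lookup-place f v)) (π-copy (choices-off q S f∈ v))
  place-embedding : ∀ {f} → f ∈ choices q S → IsEmb T G (place f)
  place-embedding f∈ = record
    { injective = λ {u} {v} eq → trans (sym (π-place f∈ u)) (trans (cong π eq) (π-place f∈ v))
    ; edges = λ {u} {v} e → subst₂ (λ a b → adj T a b ≡ true) (sym (π-place f∈ u)) (sym (π-place f∈ v)) e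
    }
  subgraph-injective : ∀ {f g} → f ∈ choices q S → g ∈ choices q S → subgraph f ≡ subgraph g → f ≡ g
  subgraph-injective {f} {g} f∈ g∈ eq = lookup-ext same
    where
    same : ∀ v → lookup f v ≡ lookup g v
    -- The vertex that `f` chooses for `v` also lies in the subgraph of `g`, so `g` chooses it for
    -- some `u`; applying `π` gives `u ≡ v`.
    same v with u , h ← ∃ᵇ⁻ (trans (sym (Vec.lookup∘tabulate (λ x → ∃ᵇ λ u → lookup (place g) u == x) (lookup (place f) v)))
        (trans (cong (λ d → lookup (proj₁ d) (lookup (place f) v)) (sym eq))
          (trans (Vec.lookup∘tabulate _ (lookup (place f) v)) (∃ᵇ⁺ v (==-refl (lookup (place f) v))))))
      with p ← ==⁻ {i = lookup (place g) u} {lookup (place f) v} h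
      with refl ← trans (sym (π-place g∈ u)) (trans (cong π p) (π-place f∈ v))
      = copy-injective (trans (sym (lookup-place f v)) (trans (sym p) (lookup-place g v)))

-- Vertex i of the blow-up is a copy of i mod n T, or of v₀ if that vertex may not have any further copies.
round-robin : (T : Graph) .{{_ : NonZero (n T)}} (S : Subset (n T)) {v₀ : V T} → lookup S v₀ ≡ true →
  (q m : ℕ) → suc q * n T ≤ m → Blowup T S q m
round-robin T S {v₀} v₀∈S q m fits = record
  { π = π ; copy = copy ; π-copy = λ {v} {j} → π-copy v j ; only-copy = λ {i} → only-copy i
  ; copy-injective = λ {v} {i} {j} → copy-injective v i j }
  where
  k = n T
  r : Fin m → V T
  r i = Fin.fromℕ< (m%n<n (toℕ i) k)
  toℕ-r : ∀ i → toℕ (r i) ≡ toℕ i % k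
  toℕ-r i = Fin.toℕ-fromℕ< _
  π : Fin m → V T
  π i with toℕ i ℕ.<? k | lookup S (r i) 𝔹.≟ true
  ... | yes _ | _ = r i
  ... | no _ | yes _ = r i
  ... | no _ | no _ = v₀
  copy< : ∀ (v : V T) (j : Fin (suc q)) → toℕ v + toℕ j * k < m
  copy< v j = ℕ.≤-trans (ℕ.+-monoˡ-≤ (toℕ j * k) (Fin.toℕ<n v)) (ℕ.≤-trans (ℕ.*-monoˡ-≤ k (Fin.toℕ<n j)) fits)
  copy : V T → Fin (suc q) → Fin m
  copy v j = Fin.fromℕ< (copy< v j)
  toℕ-copy : ∀ v j → toℕ (copy v j) ≡ toℕ v + toℕ j * k
  toℕ-copy v j = Fin.toℕ-fromℕ< _
  r-copy : ∀ v j → r (copy v j) ≡ v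
  r-copy v j = Fin.toℕ-injective (trans (toℕ-r (copy v j)) (trans (cong (_% k) (toℕ-copy v j))
    (trans ([m+kn]%n≡m%n (toℕ v) (toℕ j) k) (m<n⇒m%n≡m (Fin.toℕ<n v)))))
  π-copy : ∀ v j → lookup S v ≡ true ⊎ j ≡ zero → π (copy v j) ≡ v
  π-copy v j h with toℕ (copy v j) ℕ.<? k | lookup S (r (copy v j)) 𝔹.≟ true
  ... | yes _ | _ = r-copy v j
  ... | no _ | yes _ = r-copy v j
  π-copy v j (inj₁ v∈S) | no _ | no r∉S = ⊥-elim (r∉S (trans (cong (lookup S) (r-copy v j)) v∈S))
  π-copy v j (inj₂ refl) | no ≥k | no _ =
    ⊥-elim (≥k (subst (_< k) (sym (trans (toℕ-copy v zero) (ℕ.+-identityʳ (toℕ v)))) (Fin.toℕ<n v)))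
  only-copy : ∀ i → lookup S (π i) ≢ true → copy (π i) zero ≡ i
  only-copy i h with toℕ i ℕ.<? k | lookup S (r i) 𝔹.≟ true
  ... | yes i<k | _ = Fin.toℕ-injective
    (trans (toℕ-copy (r i) zero) (trans (ℕ.+-identityʳ _) (trans (toℕ-r i) (m<n⇒m%n≡m i<k))))
  ... | no _ | yes r∈S = ⊥-elim (h r∈S)
  ... | no _ | no _ = ⊥-elim (h v₀∈S)
  copy-injective : ∀ v i j → copy v i ≡ copy v j → i ≡ j
  copy-injective v i j eq = Fin.toℕ-injective (ℕ.*-cancelʳ-≡ (toℕ i) (toℕ j) k (ℕ.+-cancelˡ-≡ (toℕ v) _ _
    (trans (sym (toℕ-copy v i)) (trans (cong toℕ eq) (toℕ-copy v j)))))

-- The lower bound and both bounds together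

lower-bound : (s : ℕ) → 1 ≤ s → (T : Graph) → Forest T → Rooting T → V T → ∀ m → n T ≤ m →
  ∃ λ G → TreewidthAtMost s G × n G ≡ m × m ^ α s T ≤ (2 * n T) ^ α s T * C T G
lower-bound s 1≤s T forest R x₀ m k≤m with S , ∣S∣≡α , low , stable ← α-attained s T
  = pull T (Blowup.π B) , BlowupTreewidth.decomposition R 1≤s low stable B , refl , (begin
    m ^ a                             ≤⟨ ℕ.^-monoˡ-≤ a m≤2kq ⟩
    (2 * k * (m / k)) ^ a             ≡⟨ ^-distribʳ-* (2 * k) (m / k) a ⟩
    (2 * k) ^ a * (m / k) ^ a         ≡⟨ cong₂ (λ q b → (2 * k) ^ a * q ^ b) (sym 1+q) (sym ∣S∣≡α) ⟩
    (2 * k) ^ a * suc q ^ ∣ S ∣       ≤⟨ ℕ.*-monoʳ-≤ ((2 * k) ^ a) (blowup-copies B) ⟩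
    (2 * k) ^ a * C T (pull T (Blowup.π B)) ∎)
  where
  open ℕ.≤-Reasoning
  a = α s T
  k = n T
  instance
    k≢0 : NonZero k
    k≢0 = >-nonZero (ℕ.≤-trans (s≤s z≤n) (Fin.toℕ<n x₀))
  -- Blow-ups have `suc q` copies of each vertex in `S`; `m / k` is positive because `k ≤ m`.
  q = pred (m / k)
  m/k≥1 : 1 ≤ m / k
  m/k≥1 = m≥n⇒m/n>0 k≤m
  1+q : suc q ≡ m / k
  1+q = ℕ.suc-pred (m / k) {{>-nonZero m/k≥1}}
  fits : suc q * k ≤ m
  fits = ℕ.≤-trans (ℕ.≤-reflexive (cong (_* k) 1+q)) (m/n*n≤m m k)
  nonempty : ∃ λ v → lookup S v ≡ true
  nonempty with elems S in eq
  ... | [] = ⊥-elim (ℕ.<⇒≱ (forest⇒α≥1 s 1≤s T forest x₀)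
    (ℕ.≤-reflexive (trans (sym ∣S∣≡α) (trans (sym (length-elems S)) (cong length eq)))))
  ... | v ∷ _ = v , ∈-elems⁻ S (subst (v ∈_) (sym eq) (here refl))
  B : Blowup T S q m
  B = round-robin T S (proj₂ nonempty) q m fits
  -- The remainder is below `k`, hence at most another `k * (m / k)`. This is the origin of the
  -- factor 2 in the constant.
  m≤2kq : m ≤ 2 * k * (m / k)
  m≤2kq = begin
    m                          ≡⟨ m≡m%n+[m/n]*n m k ⟩
    m % k + m / k * k          ≤⟨ ℕ.+-monoˡ-≤ (m / k * k) (ℕ.<⇒≤ (m%n<n m k)) ⟩
    k + m / k * k              ≤⟨ ℕ.+-monoˡ-≤ (m / k * k) (ℕ.m≤n*m k (m / k) {{>-nonZero m/k≥1}}) ⟩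
    m / k * k + m / k * k      ≡⟨ sym (cong (m / k * k +_) (ℕ.+-identityʳ (m / k * k))) ⟩
    2 * (m / k * k)            ≡⟨ cong (2 *_) (ℕ.*-comm (m / k) k) ⟩
    2 * (k * (m / k))          ≡⟨ sym (ℕ.*-assoc 2 k (m / k)) ⟩
    2 * k * (m / k)            ∎

singleton-forest : Forest (Complete 1)
singleton-forest (k , c , inj , _) = ℕ.<⇒≱ (s≤s (s≤s z≤n)) (Fin.injective⇒≤ {f = c} inj)

-- The blow-ups of the one-vertex forest, which the lower bound already provides, are edgeless
-- graphs of every positive order.
graph-of-order : (s : ℕ) → 1 ≤ s → ∀ m → 1 ≤ m → ∃ λ G → TreewidthAtMost s G × n G ≡ m
graph-of-order s 1≤s m 1≤m =
  let G , tw , nG≡m , _ = lower-bound s 1≤s (Complete 1) singleton-forest (forest⇒rooting _ singleton-forest) zero m 1≤m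
  in G , tw , nG≡m

-- The empty forest has no blow-up with `m` vertices. But its exponent is 0, and every graph
-- contains the empty subgraph as a copy.
lower-bound-empty : (s : ℕ) → 1 ≤ s → (T : Graph) → n T ≡ 0 → ∀ m → 1 ≤ m →
  ∃ λ G → TreewidthAtMost s G × n G ≡ m × m ^ α s T ≤ 1 * C T G
lower-bound-empty s 1≤s T empty m 1≤m with G , tw , nG≡m ← graph-of-order s 1≤s m 1≤m
  = G , tw , nG≡m , (begin
    m ^ α s T  ≡⟨ cong (m ^_) α≡0 ⟩
    1          ≤⟨ copies≥ T G (image-subgraph T e ∷ []) ([] ∷ []) (λ { (here refl) → embedding⇒copy T G e emb }) ⟩
    C T G      ≡⟨ sym (ℕ.*-identityˡ (C T G)) ⟩
    1 * C T G  ∎)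
  where
  open ℕ.≤-Reasoning
  absurd : {A : Set} → V T → A
  absurd v = ⊥-elim (Fin.¬Fin0 (subst Fin empty v))
  e : Vec (V G) (n T)
  e = Vec.tabulate absurd
  emb : IsEmb T G e
  emb = record { injective = λ {u} → absurd u ; edges = λ {u} → absurd u }
  α≡0 : α s T ≡ 0
  α≡0 with S , ∣S∣≡α , _ ← α-attained s T =
    ℕ.n≤0⇒n≡0 (ℕ.≤-trans (ℕ.≤-reflexive (sym ∣S∣≡α)) (ℕ.≤-trans (Subset.∣p∣≤n S) (ℕ.≤-reflexive empty)))

theorem2 : (s t : ℕ) → 1 ≤ s → 1 ≤ t →
    (𝒢 : Graph → Set) → MinorClosed 𝒢 →
    (∀ G → TreewidthAtMost s G → 𝒢 G) →
    ¬ 𝒢 (K (1 + s) t) →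
    (T : Graph) → Forest T →
    Σ ℕ λ c₁ → Σ ℕ λ c₂ → Σ ℕ λ N → ∀ m → N ≤ m →
    (∀ G → 𝒢 G → n G ≡ m → C T G ≤ c₂ * m ^ α s T)
    × (Σ Graph λ G → 𝒢 G × n G ≡ m × m ^ α s T ≤ c₁ * C T G)
theorem2 s t 1≤s 1≤t 𝒢 (_ , closed) tw⊆𝒢 K∉𝒢 T forest
  with R ← forest⇒rooting T forest
  with c₂ , upper ← upper-bound s t 1≤s 1≤t 𝒢 closed K∉𝒢 T R
  with n T ℕ.≟ 0
-- The threshold 1 provides the vertex that the upper bound uses as a placeholder.
... | yes empty = 1 , c₂ , 1 , λ m 1≤m → upper m 1≤m ,
  (let G , tw , nG≡m , many = lower-bound-empty s 1≤s T empty m 1≤m in G , tw⊆𝒢 G tw , nG≡m , many)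
-- From `n T` vertices on, there is room for at least one copy of each vertex of `T`.
... | no nonempty = (2 * n T) ^ α s T , c₂ , n T , λ m k≤m → upper m (ℕ.≤-trans k≥1 k≤m) ,
  (let G , tw , nG≡m , many = lower-bound s 1≤s T forest R (Fin.fromℕ< k≥1) m k≤m in G , tw⊆𝒢 G tw , nG≡m , many)
  where
  k≥1 : 1 ≤ n T
  k≥1 = ℕ.n≢0⇒n>0 nonempty
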